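{- Let $\mathcal{P}_{2,3}$ be the set of odd primes $p$ with $p\equiv3\pmod4$ such that the order $s$ of $2$ in $(\mathbb{Z}/p\mathbb{Z})^*$ equals $\frac{p-1}{2}$. There exists no prime number $p\in\mathcal{P}_{2,3}$ for which $\beta>1/2$.
   Context: $\eta_n=(-1)^{s_2(n)}$ for $n\ge0$, where $s_2(n)$ is the sum of the binary digits of $n$. For an odd prime $p$ and $i\in\mathbb{Z}/p\mathbb{Z}$, the $p$-rarefied sum is $S_{p,i}(n)=\sum_{0\le j<n,\ j\equiv i\,(\mathrm{mod}\,p)}\eta_j$. With $s$ the order of $2$ in $(\mathbb{Z}/p\mathbb{Z})^*$, $\lambda_1$ denotes the largest modulus of an eigenvalue of the $p\times p$ matrix $M=(S_{p,i-j}(2^s))_{0\le i,j\le p-1}$ (indices $i-j$ taken mod $p$), and $\beta=\beta(p)=\frac{\log\lambda_1}{s\log2}$. -}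

module Defs where

open import Algebra.Bundles.Raw using (RawRing)
import Algebra.Definitions.RawSemiring as RawSemiringDefs
open import Data.Digit using (toDigits)
open import Data.Fin.Base using (Fin; toℕ)
open import Data.Integer.Base as ℤ using (ℤ; +_; 0ℤ; -1ℤ)
open import Data.Integer.Divisibility.Signed using (_∣_; _∣?_)
open import Data.List.Base using (map; filter; foldr; upTo)
open import Data.Nat.Base as ℕ using (ℕ; suc; _⊔_)
open import Data.Nat.ListAction using (sum)
import Data.Nat.Properties as ℕ
open import Data.Nat.Primality using (Prime)
open import Data.Product.Base using (∃-syntax; Σ; _×_; _,_; proj₁)
open import Data.Rational.Base as ℚ using (ℚ; 0ℚ; 1ℚ; ½; ∣_∣; 1/_)
import Data.Rational.Properties as ℚ
open import Data.Rational.Solver using (module +-*-Solver)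
open import Level using (0ℓ)
open import Relation.Binary.PropositionalEquality
  using (_≡_; _≢_; refl; sym; trans; cong; cong₂; subst)
open import Relation.Nullary using (¬_)

private abstract
  half+half : ∀ ε → ε ℚ.* ½ ℚ.+ ε ℚ.* ½ ≡ ε
  half+half ε = trans (sym (ℚ.*-distribˡ-+ ε ½ ½)) (ℚ.*-identityʳ ε)

  half>0 : ∀ ε → 0ℚ ℚ.< ε → 0ℚ ℚ.< ε ℚ.* ½
  half>0 ε 0<ε = subst (ℚ._< ε ℚ.* ½) (ℚ.*-zeroˡ ½) (ℚ.*-monoˡ-<-pos ½ 0<ε)

  +-split : ∀ a b c d → (a ℚ.+ b) ℚ.- (c ℚ.+ d) ≡ (a ℚ.- c) ℚ.+ (b ℚ.- d)
  +-split = solve 4 (λ a b c d → (a :+ b) :- (c :+ d) := (a :- c) :+ (b :- d)) refl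
    where open +-*-Solver

  *-split : ∀ a b c d →
            a ℚ.* b ℚ.- c ℚ.* d ≡ a ℚ.* (b ℚ.- d) ℚ.+ d ℚ.* (a ℚ.- c)
  *-split = solve 4
    (λ a b c d → (a :* b) :- (c :* d) := (a :* (b :- d)) :+ (d :* (a :- c))) refl
    where open +-*-Solver

  shift : ∀ a b → a ≡ (a ℚ.- b) ℚ.+ b
  shift = solve 2 (λ a b → a := (a :- b) :+ b) refl
    where open +-*-Solver

------------------------------------------------------------------------
-- Real numbers: Cauchy sequences of rationals, with the equality _≃_.

IsCauchy : (ℕ → ℚ) → Set
IsCauchy x = ∀ ε → 0ℚ ℚ.< ε →
  ∃[ N ] ∀ m n → N ℕ.≤ m → N ℕ.≤ n → ∣ x m ℚ.- x n ∣ ℚ.< ε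

record ℝ : Set where
  constructor mkℝ
  field
    seq    : ℕ → ℚ
    cauchy : IsCauchy seq

open ℝ public

infix 4 _≃_ _<ℝ_ _≤ℝ_

_≃_ : ℝ → ℝ → Set
x ≃ y = ∀ ε → 0ℚ ℚ.< ε → ∃[ N ] ∀ n → N ℕ.≤ n → ∣ seq x n ℚ.- seq y n ∣ ℚ.< ε

_<ℝ_ : ℝ → ℝ → Set
x <ℝ y = ∃[ ε ] 0ℚ ℚ.< ε × ∃[ N ] ∀ n → N ℕ.≤ n → seq x n ℚ.+ ε ℚ.≤ seq y n

_≤ℝ_ : ℝ → ℝ → Set
x ≤ℝ y = ¬ (y <ℝ x)

private abstract
  const-cauchy : ∀ q → IsCauchy (λ _ → q)
  const-cauchy q ε 0<ε = 0 , λ _ _ _ _ →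
    subst (ℚ._< ε) (sym (cong ∣_∣ (ℚ.+-inverseʳ q))) 0<ε

  +-cauchy : ∀ {x y} → IsCauchy x → IsCauchy y → IsCauchy (λ n → x n ℚ.+ y n)
  +-cauchy {x} {y} cx cy ε 0<ε
    with cx (ε ℚ.* ½) (half>0 ε 0<ε) | cy (ε ℚ.* ½) (half>0 ε 0<ε)
  ... | N₁ , p₁ | N₂ , p₂ = N₁ ⊔ N₂ , λ m n m≥ n≥ → begin-strict
    ∣ (x m ℚ.+ y m) ℚ.- (x n ℚ.+ y n) ∣
      ≡⟨ cong ∣_∣ (+-split (x m) (y m) (x n) (y n)) ⟩
    ∣ (x m ℚ.- x n) ℚ.+ (y m ℚ.- y n) ∣
      ≤⟨ ℚ.∣p+q∣≤∣p∣+∣q∣ (x m ℚ.- x n) (y m ℚ.- y n) ⟩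
    ∣ x m ℚ.- x n ∣ ℚ.+ ∣ y m ℚ.- y n ∣
      <⟨ ℚ.+-mono-< (p₁ m n (ℕ.m⊔n≤o⇒m≤o N₁ N₂ m≥) (ℕ.m⊔n≤o⇒m≤o N₁ N₂ n≥))
                    (p₂ m n (ℕ.m⊔n≤o⇒n≤o N₁ N₂ m≥) (ℕ.m⊔n≤o⇒n≤o N₁ N₂ n≥)) ⟩
    ε ℚ.* ½ ℚ.+ ε ℚ.* ½
      ≡⟨ half+half ε ⟩
    ε ∎
    where open ℚ.≤-Reasoning

  neg-cauchy : ∀ {x} → IsCauchy x → IsCauchy (λ n → ℚ.- x n)
  neg-cauchy {x} cx ε 0<ε with cx ε 0<ε
  ... | N , p = N , λ m n m≥ n≥ → subst (ℚ._< ε)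
    (trans (sym (ℚ.∣-p∣≡∣p∣ (x m ℚ.- x n)))
           (cong ∣_∣ (ℚ.neg-distrib-+ (x m) (ℚ.- x n))))
    (p m n m≥ n≥)

  eventuallyBounded : ∀ {x} → IsCauchy x →
    ∃[ B ] ∃[ N ] 0ℚ ℚ.< B × ∀ n → N ℕ.≤ n → ∣ x n ∣ ℚ.≤ B
  eventuallyBounded {x} cx with cx 1ℚ (ℚ.positive⁻¹ 1ℚ)
  ... | N , p = 1ℚ ℚ.+ ∣ x N ∣ , N ,
    ℚ.+-mono-<-≤ (ℚ.positive⁻¹ 1ℚ) (ℚ.0≤∣p∣ (x N)) , λ n n≥ → begin
      ∣ x n ∣                           ≡⟨ cong ∣_∣ (shift (x n) (x N)) ⟩
      ∣ (x n ℚ.- x N) ℚ.+ x N ∣         ≤⟨ ℚ.∣p+q∣≤∣p∣+∣q∣ (x n ℚ.- x N) (x N) ⟩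
      ∣ x n ℚ.- x N ∣ ℚ.+ ∣ x N ∣       ≤⟨ ℚ.+-monoˡ-≤ ∣ x N ∣
                                             (ℚ.<⇒≤ (p n N n≥ ℕ.≤-refl)) ⟩
      1ℚ ℚ.+ ∣ x N ∣                    ∎
    where open ℚ.≤-Reasoning

  ∣*∣-mono : ∀ a b B δ → 0ℚ ℚ.< B → ∣ a ∣ ℚ.≤ B → ∣ b ∣ ℚ.< δ →
             ∣ a ℚ.* b ∣ ℚ.< B ℚ.* δ
  ∣*∣-mono a b B δ 0<B a≤B b<δ = begin-strict
    ∣ a ℚ.* b ∣       ≡⟨ ℚ.∣p*q∣≡∣p∣*∣q∣ a b ⟩
    ∣ a ∣ ℚ.* ∣ b ∣   ≤⟨ ℚ.*-monoʳ-≤-nonNeg ∣ b ∣ {{ℚ.∣-∣-nonNeg b}} a≤B ⟩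
    B ℚ.* ∣ b ∣       <⟨ ℚ.*-monoʳ-<-pos B {{ℚ.positive 0<B}} b<δ ⟩
    B ℚ.* δ           ∎
    where open ℚ.≤-Reasoning

  scale : ∀ B ε → 0ℚ ℚ.< B → 0ℚ ℚ.< ε →
          ∃[ δ ] 0ℚ ℚ.< δ × B ℚ.* δ ≡ ε
  scale B ε 0<B 0<ε = B⁻¹ ℚ.* ε ,
    ℚ.positive⁻¹ (B⁻¹ ℚ.* ε) {{ℚ.pos*pos⇒pos B⁻¹ ε}} ,
    trans (sym (ℚ.*-assoc B B⁻¹ ε))
      (trans (cong (ℚ._* ε) (ℚ.*-inverseʳ B)) (ℚ.*-identityˡ ε))
    where
    instance
      B-pos : ℚ.Positive B
      B-pos = ℚ.positive 0<B
      ε-pos : ℚ.Positive ε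
      ε-pos = ℚ.positive 0<ε
      B-nz : ℚ.NonZero B
      B-nz = ℚ.pos⇒nonZero B
    B⁻¹ : ℚ
    B⁻¹ = 1/ B
    instance
      B⁻¹-pos : ℚ.Positive B⁻¹
      B⁻¹-pos = ℚ.1/pos⇒pos B

  *-cauchy-bound : ∀ (x y : ℕ → ℚ) B C δ γ N₁ N₂ N₃ N₄ →
    0ℚ ℚ.< B → (∀ n → N₁ ℕ.≤ n → ∣ x n ∣ ℚ.≤ B) →
    0ℚ ℚ.< C → (∀ n → N₂ ℕ.≤ n → ∣ y n ∣ ℚ.≤ C) →
    (∀ m n → N₃ ℕ.≤ m → N₃ ℕ.≤ n → ∣ y m ℚ.- y n ∣ ℚ.< δ) →
    (∀ m n → N₄ ℕ.≤ m → N₄ ℕ.≤ n → ∣ x m ℚ.- x n ∣ ℚ.< γ) →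
    ∀ m n → (N₁ ⊔ N₂) ⊔ (N₃ ⊔ N₄) ℕ.≤ m → (N₁ ⊔ N₂) ⊔ (N₃ ⊔ N₄) ℕ.≤ n →
    ∣ x m ℚ.* y m ℚ.- x n ℚ.* y n ∣ ℚ.< B ℚ.* δ ℚ.+ C ℚ.* γ
  *-cauchy-bound x y B C δ γ N₁ N₂ N₃ N₄ 0<B x≤B 0<C y≤C y< x< m n m≥ n≥ =
    begin-strict
    ∣ x m ℚ.* y m ℚ.- x n ℚ.* y n ∣
      ≡⟨ cong ∣_∣ (*-split (x m) (y m) (x n) (y n)) ⟩
    ∣ x m ℚ.* (y m ℚ.- y n) ℚ.+ y n ℚ.* (x m ℚ.- x n) ∣
      ≤⟨ ℚ.∣p+q∣≤∣p∣+∣q∣ (x m ℚ.* (y m ℚ.- y n)) (y n ℚ.* (x m ℚ.- x n)) ⟩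
    ∣ x m ℚ.* (y m ℚ.- y n) ∣ ℚ.+ ∣ y n ℚ.* (x m ℚ.- x n) ∣
      <⟨ ℚ.+-mono-<
           (∣*∣-mono (x m) (y m ℚ.- y n) B δ 0<B
             (x≤B m (ℕ.m⊔n≤o⇒m≤o N₁ N₂ m≥₁₂))
             (y< m n (ℕ.m⊔n≤o⇒m≤o N₃ N₄ m≥₃₄) (ℕ.m⊔n≤o⇒m≤o N₃ N₄ n≥₃₄)))
           (∣*∣-mono (y n) (x m ℚ.- x n) C γ 0<C
             (y≤C n (ℕ.m⊔n≤o⇒n≤o N₁ N₂ n≥₁₂))
             (x< m n (ℕ.m⊔n≤o⇒n≤o N₃ N₄ m≥₃₄) (ℕ.m⊔n≤o⇒n≤o N₃ N₄ n≥₃₄))) ⟩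
    B ℚ.* δ ℚ.+ C ℚ.* γ ∎
    where
    open ℚ.≤-Reasoning
    m≥₁₂ : N₁ ⊔ N₂ ℕ.≤ m
    m≥₁₂ = ℕ.m⊔n≤o⇒m≤o (N₁ ⊔ N₂) (N₃ ⊔ N₄) m≥
    m≥₃₄ : N₃ ⊔ N₄ ℕ.≤ m
    m≥₃₄ = ℕ.m⊔n≤o⇒n≤o (N₁ ⊔ N₂) (N₃ ⊔ N₄) m≥
    n≥₁₂ : N₁ ⊔ N₂ ℕ.≤ n
    n≥₁₂ = ℕ.m⊔n≤o⇒m≤o (N₁ ⊔ N₂) (N₃ ⊔ N₄) n≥
    n≥₃₄ : N₃ ⊔ N₄ ℕ.≤ n
    n≥₃₄ = ℕ.m⊔n≤o⇒n≤o (N₁ ⊔ N₂) (N₃ ⊔ N₄) n≥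

  *-cauchy : ∀ {x y} → IsCauchy x → IsCauchy y → IsCauchy (λ n → x n ℚ.* y n)
  *-cauchy {x} {y} cx cy ε 0<ε =
    let B , N₁ , 0<B , x≤B = eventuallyBounded {x} cx
        C , N₂ , 0<C , y≤C = eventuallyBounded {y} cy
        δ , 0<δ , Bδ≡      = scale B (ε ℚ.* ½) 0<B (half>0 ε 0<ε)
        γ , 0<γ , Cγ≡      = scale C (ε ℚ.* ½) 0<C (half>0 ε 0<ε)
        N₃ , y<            = cy δ 0<δ
        N₄ , x<            = cx γ 0<γ
    in (N₁ ⊔ N₂) ⊔ (N₃ ⊔ N₄) , λ m n m≥ n≥ →
      subst (∣ x m ℚ.* y m ℚ.- x n ℚ.* y n ∣ ℚ.<_)
        (trans (cong₂ ℚ._+_ Bδ≡ Cγ≡) (half+half ε))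
        (*-cauchy-bound x y B C δ γ N₁ N₂ N₃ N₄ 0<B x≤B 0<C y≤C y< x< m n m≥ n≥)

fromℚ : ℚ → ℝ
fromℚ q = mkℝ (λ _ → q) (const-cauchy q)

fromℤ : ℤ → ℝ
fromℤ i = fromℚ (i ℚ./ 1)

fromℕ : ℕ → ℝ
fromℕ n = fromℤ (+ n)

infixl 6 _+ℝ_ _-ℝ_
infixl 7 _*ℝ_
infix  8 -ℝ_

_+ℝ_ : ℝ → ℝ → ℝ
x +ℝ y = mkℝ (λ n → seq x n ℚ.+ seq y n)
             (+-cauchy {seq x} {seq y} (cauchy x) (cauchy y))

-ℝ_ : ℝ → ℝ
-ℝ x = mkℝ (λ n → ℚ.- seq x n) (neg-cauchy {seq x} (cauchy x))

_-ℝ_ : ℝ → ℝ → ℝ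
x -ℝ y = x +ℝ (-ℝ y)

_*ℝ_ : ℝ → ℝ → ℝ
x *ℝ y = mkℝ (λ n → seq x n ℚ.* seq y n)
             (*-cauchy {seq x} {seq y} (cauchy x) (cauchy y))

ℝ-rawRing : RawRing 0ℓ 0ℓ
ℝ-rawRing = record
  { Carrier = ℝ ; _≈_ = _≃_ ; _+_ = _+ℝ_ ; _*_ = _*ℝ_ ; -_ = -ℝ_
  ; 0# = fromℕ 0 ; 1# = fromℕ 1 }

open RawSemiringDefs (RawRing.rawSemiring ℝ-rawRing) public
  using () renaming (_^_ to _^ℝ_)

TendsTo : (ℕ → ℝ) → ℝ → Set
TendsTo a l = ∀ ε → 0ℚ ℚ.< ε → ∃[ N ] ∀ n → N ℕ.≤ n →
  (-ℝ fromℚ ε <ℝ a n -ℝ l) × (a n -ℝ l <ℝ fromℚ ε)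

-- exp y = lim (1 + y/n)ⁿ; the index is shifted by one so that n is nonzero.
IsExp : ℝ → ℝ → Set
IsExp y x =
  TendsTo (λ n → (fromℕ 1 +ℝ y *ℝ fromℚ (+ 1 ℚ./ suc n)) ^ℝ suc n) x

-- IsLog x y means y = log x, the natural logarithm being the inverse of exp.
IsLog : ℝ → ℝ → Set
IsLog x y = IsExp y x

------------------------------------------------------------------------
-- Complex numbers

record ℂ : Set where
  constructor _+i_
  field
    re im : ℝ

open ℂ public

infix 4 _≃ᶜ_

_≃ᶜ_ : ℂ → ℂ → Set
z ≃ᶜ w = (re z ≃ re w) × (im z ≃ im w)

ℂ-rawRing : RawRing 0ℓ 0ℓ
ℂ-rawRing = record
  { Carrier = ℂ
  ; _≈_ = _≃ᶜ_
  ; _+_ = λ z w → (re z +ℝ re w) +i (im z +ℝ im w)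
  ; _*_ = λ z w → (re z *ℝ re w -ℝ im z *ℝ im w) +i (re z *ℝ im w +ℝ im z *ℝ re w)
  ; -_  = λ z → (-ℝ re z) +i (-ℝ im z)
  ; 0#  = fromℕ 0 +i fromℕ 0
  ; 1#  = fromℕ 1 +i fromℕ 0
  }

open RawRing ℂ-rawRing public using () renaming (_*_ to _*ᶜ_; 0# to 0ᶜ)
open RawSemiringDefs (RawRing.rawSemiring ℂ-rawRing) public
  using () renaming (sum to sumᶜ)

ℤ⇒ℂ : ℤ → ℂ
ℤ⇒ℂ i = fromℤ i +i fromℕ 0

-- IsModulus z r means r = |z|.
IsModulus : ℂ → ℝ → Set
IsModulus z r = (fromℕ 0 ≤ℝ r) × (r *ℝ r ≃ re z *ℝ re z +ℝ im z *ℝ im z)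

IsEigenvalue : ∀ {n} → (Fin n → Fin n → ℂ) → ℂ → Set
IsEigenvalue {n} A μ = Σ (Fin n → ℂ) λ v →
  (¬ (∀ i → v i ≃ᶜ 0ᶜ)) ×
  (∀ i → sumᶜ (λ j → A i j *ᶜ v j) ≃ᶜ μ *ᶜ v i)

IsLargestEigenvalueModulus : ∀ {n} → (Fin n → Fin n → ℂ) → ℝ → Set
IsLargestEigenvalueModulus A r =
  (∃[ μ ] IsEigenvalue A μ × IsModulus μ r) ×
  (∀ μ t → IsEigenvalue A μ → IsModulus μ t → t ≤ℝ r)

------------------------------------------------------------------------
-- Rarefied sums of the Thue–Morse sequence

infix 4 _≡_[mod_]

_≡_[mod_] : ℤ → ℤ → ℕ → Set
a ≡ b [mod p ] = + p ∣ a ℤ.- b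

s₂ : ℕ → ℕ
s₂ n = sum (map toℕ (proj₁ (toDigits 2 n)))

η : ℕ → ℤ
η n = -1ℤ ℤ.^ s₂ n

-- The residue class i ∈ ℤ/pℤ is given by an arbitrary integer representative.
S : ℕ → ℤ → ℕ → ℤ
S p i n = foldr ℤ._+_ 0ℤ (map η (filter (λ j → + p ∣? + j ℤ.- i) (upTo n)))

M : (p s : ℕ) → Fin p → Fin p → ℂ
M p s i j = ℤ⇒ℂ (S p (+ toℕ i ℤ.- + toℕ j) (2 ℕ.^ s))

-- s is the order of 2 in (ℤ/pℤ)*
IsOrderOf2 : ℕ → ℕ → Set
IsOrderOf2 p s =
  0 ℕ.< s ×
  (+ (2 ℕ.^ s) ≡ + 1 [mod p ]) ×
  (∀ t → 0 ℕ.< t → + (2 ℕ.^ t) ≡ + 1 [mod p ] → s ℕ.≤ t)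

-- b is the number β(p) = log λ₁ / (s log 2); the quotient is expressed by
-- b · (s log 2) = log λ₁, where s log 2 ≠ 0.
record IsBeta (p : ℕ) (b : ℝ) : Set where
  field
    s                : ℕ
    λ₁ log-λ₁ log-2  : ℝ
    s-order          : IsOrderOf2 p s
    λ₁-largest       : IsLargestEigenvalueModulus (M p s) λ₁
    log-λ₁-log       : IsLog λ₁ log-λ₁
    log-2-log        : IsLog (fromℕ 2) log-2
    b-quotient       : b *ℝ (fromℕ s *ℝ log-2) ≃ log-λ₁

P₂₃ : ℕ → Set
P₂₃ p = Prime p × p ≢ 2 × p ℕ.% 4 ≡ 3 × IsOrderOf2 p ((p ℕ.∸ 1) ℕ./ 2)

{-# OPTIONS --safe #-}
module Submission where

-- Let T be the shift of p-periodic sequences.  By the product formula for the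
-- Thue–Morse signs, M acts as ∏_{m < s} (1 − T^(2ᵐ)), up to reflection, and its
-- transpose as ∏_{m < s} (1 − T^(−2ᵐ)).  As s = (p − 1) / 2 is odd, −1 is not a
-- power of 2 modulo p, so the exponents ±2ᵐ run through all nonzero residues and
-- Mᵀ M = ∏_{0 < a < p} (1 − Tᵃ) = p − J, where J is the all-ones matrix.  Hence
-- |Mv|² ≤ p |v|² and λ₁² ≤ p, whereas 2ˢ ≡ 1 (mod p) gives p < 2ˢ.
--
-- If β > 1/2, then log λ₁ exceeds (s/2) log 2, and comparing
-- (1 + log λ₁ / sj)^(2sj) with (1 + log 2 / 2j)^(2js) yields λ₁² ≥ 2ˢ.

open import Defs
open import Algebra.Bundles using (CommutativeRing)
import Algebra.Properties.CommutativeSemigroup as CommutativeSemigroupProperties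
import Algebra.Properties.CommutativeSemiring.Exp as SemiringExp
import Algebra.Properties.Semiring.Sum as SemiringSum
open import Data.Bool.Base using (if_then_else_)
open import Data.Digit using (fromDigits; toDigits)
open import Data.Empty using (⊥)
open import Data.Fin.Base using (Fin; zero; suc; toℕ)
import Data.Fin.Properties as Fin
open import Data.Integer.Base as ℤ using (ℤ; +_; -1ℤ; 0ℤ; 1ℤ)
open import Data.Integer.Divisibility.Signed
  using (_∣_; _∣?_; divides; ∣⇒∣ᵤ; ∣ᵤ⇒∣; ∣-refl; ∣m∣n⇒∣m+n; ∣m∣n⇒∣m-n; ∣n⇒∣m*n; ∣m⇒∣m*n)
import Data.Integer.Properties as ℤ
import Data.Integer.Tactic.RingSolver as ℤSolver
open import Data.List.Base as List
  using (List; []; _∷_; _++_; _∷ʳ_; map; filter; foldr; length; upTo; applyUpTo)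
open import Data.List.Membership.Propositional using (_∈_)
open import Data.List.Membership.Propositional.Properties
  using (∈-∃++; ∈-++⁻; ∈-++⁺ˡ; ∈-++⁺ʳ; ∈-applyUpTo⁺; ∈-applyUpTo⁻)
import Data.List.Properties as List
open import Data.List.Relation.Binary.Permutation.Propositional
  using (_↭_; refl; prep; swap; trans; ↭-sym)
import Data.List.Relation.Binary.Permutation.Propositional.Properties as ↭
open import Data.List.Relation.Binary.Subset.Propositional using (_⊆_)
open import Data.List.Relation.Unary.All as All using (All; []; _∷_)
import Data.List.Relation.Unary.All.Properties as All
open import Data.List.Relation.Unary.AllPairs using ([]; _∷_)
open import Data.List.Relation.Unary.Any using (here; there)
open import Data.List.Relation.Unary.Unique.Propositional using (Unique)
import Data.List.Relation.Unary.Unique.Propositional.Properties as Unique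
open import Data.Nat.Base as ℕ using (ℕ; zero; suc; z≤n; s≤s; NonZero; _⊔_)
open import Data.Nat.Coprimality as Coprimality using (Coprime; coprime-Bézout; prime⇒coprime)
import Data.Nat.Divisibility as ℕ
open import Data.Nat.DivMod
  using (_%_; _/_; m≡m%n+[m/n]*n; m%n<n; m%n≤n; [m+kn]%n≡m%n; m*n/n≡m)
open import Data.Nat.GCD using (module Bézout)
open import Data.Nat.ListAction using () renaming (sum to sumℕ)
open import Data.Nat.Primality using (Prime; euclidsLemma; prime⇒nonTrivial)
import Data.Nat.Properties as ℕ
import Data.Nat.Tactic.RingSolver as ℕSolver
open import Data.Product.Base using (∃-syntax; _×_; _,_; proj₁; proj₂)
open import Data.Rational.Base as ℚ using (ℚ; 0ℚ; 1ℚ; ∣_∣; ½; toℚᵘ; _+_; _*_; _-_; _≤_; _<_)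
import Data.Rational.Properties as ℚ
open import Data.Rational.Solver using (module +-*-Solver)
open import Data.Rational.Unnormalised.Base as ℚᵘ using (mkℚᵘ; *≡*; *≤*)
import Data.Rational.Unnormalised.Properties as ℚᵘ
open import Data.Sum.Base using (inj₁; inj₂)
open import Function.Base using (_∘_; _$_; id)
open import Relation.Binary.PropositionalEquality as ≡
  using (_≡_; _≢_; cong; cong₂; subst; module ≡-Reasoning)
open import Relation.Nullary using (¬_; contradiction; Dec; yes; no; does)
open import Relation.Nullary.Decidable using (toWitness)

open CommutativeSemigroupProperties ℕ.+-commutativeSemigroup using () renaming (x∙yz≈y∙xz to +-swapˡ)
open SemiringSum (CommutativeRing.semiring ℚ.+-*-commutativeRing)
  using (sum; ∑-distrib-+; ∑-comm; *-distribˡ-sum; *-distribʳ-sum; sum-init-last; sum-cong-≗)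
open SemiringExp (CommutativeRing.commutativeSemiring ℚ.+-*-commutativeRing)
  using (_^_; ^-homo-*; ^-assocʳ; ^-distrib-*)

-- Finite differences of periodic sequences

-- The identity ∏ (1 - Tᵃ) = p - J is usually read off from the p-th roots of unity; here it is
-- derived over ℚ. For 0 < k < p, the k-th elementary symmetric function of all the Tᵃ is fixed by
-- Tᵏ and by Tᵖ, hence by T, so it takes constant values. Dividing the generating polynomial by 1 -
-- y then shows that the coefficients of ∏ (1 - y Tᵃ), 0 < a < p, agree up to constants, and at y =
-- 1 there are p of them. The reals are Cauchy sequences and exp enters only as a limit of powers,
-- so the analysis is run on rational approximants: the norm bound holds exactly for every rational
-- vector, and the powers are compared at finite stages. The accumulated errors fit because p + 1 ≤
-- 2ˢ, so that a whole unit separates λ₁² from 2ˢ.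

Σ< : ℕ → (ℕ → ℚ) → ℚ
Σ< n f = sum {n} (λ i → f (toℕ i))

Σ<-cong : ∀ n {f g} → (∀ i → f i ≡ g i) → Σ< n f ≡ Σ< n g
Σ<-cong n f≗g = sum-cong-≗ {n} (λ i → f≗g (toℕ i))

Σ<-last : ∀ n f → Σ< (suc n) f ≡ Σ< n f + f n
Σ<-last n f = ≡.trans (sum-init-last {n} (λ i → f (toℕ i)))
  (cong₂ _+_ (sum-cong-≗ {n} (λ i → cong f (Fin.toℕ-inject₁ i))) (cong f (Fin.toℕ-fromℕ n)))

sum-distrib-minus : ∀ {n} (f g : Fin n → ℚ) → sum (λ i → f i - g i) ≡ sum f - sum g
sum-distrib-minus {zero}  f g = ≡.refl
sum-distrib-minus {suc n} f g = begin
  (f zero - g zero) + sum (λ i → f (suc i) - g (suc i))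
    ≡⟨ cong ((f zero - g zero) ℚ.+_) (sum-distrib-minus (f ∘ suc) (g ∘ suc)) ⟩
  (f zero - g zero) + (sum (f ∘ suc) - sum (g ∘ suc))
    ≡⟨ solve 4 (λ a b c d → (a :- b) :+ (c :- d) := (a :+ c) :- (b :+ d)) ≡.refl
         (f zero) (g zero) (sum (f ∘ suc)) (sum (g ∘ suc)) ⟩
  sum f - sum g ∎
  where open ≡-Reasoning; open +-*-Solver

Σ<-reverse : ∀ n (f : ℕ → ℚ) → Σ< n (λ i → f (n ℕ.∸ i)) ≡ Σ< n (λ i → f (suc i))
Σ<-reverse zero    f = ≡.refl
Σ<-reverse (suc n) f = begin
  f (suc n) + Σ< n (λ i → f (n ℕ.∸ i)) ≡⟨ cong (f (suc n) ℚ.+_) (Σ<-reverse n f) ⟩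
  f (suc n) + Σ< n (λ i → f (suc i))   ≡⟨ ℚ.+-comm (f (suc n)) (Σ< n (λ i → f (suc i))) ⟩
  Σ< n (λ i → f (suc i)) + f (suc n)   ≡⟨ Σ<-last n (λ i → f (suc i)) ⟨
  Σ< (suc n) (λ i → f (suc i))         ∎
  where open ≡-Reasoning

Σ<-pairs : ∀ n f → Σ< (2 ℕ.* n) f ≡ Σ< n (λ i → f (2 ℕ.* i) + f (suc (2 ℕ.* i)))
Σ<-pairs zero    f = ≡.refl
Σ<-pairs (suc n) f = begin
  Σ< (2 ℕ.* suc n) f
    ≡⟨ cong (λ m → Σ< m f) (double-suc n) ⟩
  f 0 + (f 1 + Σ< (2 ℕ.* n) (λ i → f (suc (suc i))))
    ≡⟨ ℚ.+-assoc (f 0) (f 1) _ ⟨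
  (f 0 + f 1) + Σ< (2 ℕ.* n) (λ i → f (suc (suc i)))
    ≡⟨ cong ((f 0 + f 1) ℚ.+_) (Σ<-pairs n (λ i → f (suc (suc i)))) ⟩
  (f 0 + f 1) + Σ< n (λ i → f (suc (suc (2 ℕ.* i))) + f (suc (suc (suc (2 ℕ.* i)))))
    ≡⟨ cong ((f 0 + f 1) ℚ.+_) (Σ<-cong n (λ i →
         cong₂ (λ a b → f a + f b) (double-suc i) (cong suc (double-suc i)))) ⟨
  Σ< (suc n) (λ i → f (2 ℕ.* i) + f (suc (2 ℕ.* i))) ∎
  where
  open ≡-Reasoning
  double-suc : ∀ m → 2 ℕ.* suc m ≡ suc (suc (2 ℕ.* m))
  double-suc = ℕSolver.solve-∀

Periodic : ℕ → (ℕ → ℚ) → Set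
Periodic p f = ∀ i → f (p ℕ.+ i) ≡ f i

periodic-* : ∀ {p f} → Periodic p f → ∀ k i → f (k ℕ.* p ℕ.+ i) ≡ f i
periodic-*         per zero    i = ≡.refl
periodic-* {p} {f} per (suc k) i =
  ≡.trans (cong f (ℕ.+-assoc p (k ℕ.* p) i)) (≡.trans (per _) (periodic-* per k i))

periodic-% : ∀ {p f} .{{_ : NonZero p}} → Periodic p f → ∀ a i → f (a % p ℕ.+ i) ≡ f (a ℕ.+ i)
periodic-% {p} {f} per a i = begin
  f (a % p ℕ.+ i)                           ≡⟨ periodic-* per (a / p) _ ⟨
  f (a / p ℕ.* p ℕ.+ (a % p ℕ.+ i))         ≡⟨ cong f (ℕ.+-assoc (a / p ℕ.* p) (a % p) i) ⟨
  f (a / p ℕ.* p ℕ.+ a % p ℕ.+ i)           ≡⟨ cong (λ m → f (m ℕ.+ i)) (ℕ.+-comm (a / p ℕ.* p) (a % p)) ⟩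
  f (a % p ℕ.+ a / p ℕ.* p ℕ.+ i)           ≡⟨ cong (λ m → f (m ℕ.+ i)) (m≡m%n+[m/n]*n a p) ⟨
  f (a ℕ.+ i)                               ∎
  where open ≡-Reasoning

Σ<-suc : ∀ p {f} → Periodic p f → Σ< p (λ i → f (suc i)) ≡ Σ< p f
Σ<-suc p {f} per = begin
  Σ< p (f ∘ suc)
    ≡⟨ solve 2 (λ x y → x := (y :+ x) :- y) ≡.refl (Σ< p (f ∘ suc)) (f 0) ⟩
  Σ< (suc p) f - f 0
    ≡⟨ cong₂ _-_ (Σ<-last p f) (≡.trans (≡.sym (per 0)) (cong f (ℕ.+-identityʳ p))) ⟩
  (Σ< p f + f p) - f p
    ≡⟨ solve 2 (λ x y → (x :+ y) :- y := x) ≡.refl (Σ< p f) (f p) ⟩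
  Σ< p f ∎
  where open ≡-Reasoning; open +-*-Solver

Σ<-shift : ∀ p {f} → Periodic p f → ∀ a → Σ< p (λ i → f (a ℕ.+ i)) ≡ Σ< p f
Σ<-shift p per zero = ≡.refl
Σ<-shift p {f} per (suc a) = begin
  Σ< p (λ i → f (suc (a ℕ.+ i)))    ≡⟨ Σ<-cong p (λ i → cong f (≡.sym (ℕ.+-suc a i))) ⟩
  Σ< p (λ i → f (a ℕ.+ suc i))      ≡⟨ Σ<-suc p shifted ⟩
  Σ< p (λ i → f (a ℕ.+ i))          ≡⟨ Σ<-shift p per a ⟩
  Σ< p f                            ∎
  where
  open ≡-Reasoning
  shifted : Periodic p (λ i → f (a ℕ.+ i))
  shifted i = ≡.trans (cong f (+-swapˡ a p i)) (per (a ℕ.+ i))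

Σ<-reflect : ∀ p {f} → Periodic p f → Σ< p (λ i → f (p ℕ.∸ i)) ≡ Σ< p f
Σ<-reflect p {f} per = ≡.trans (Σ<-reverse p f) (Σ<-suc p per)

-- The factor 1 - Tᵃ. Sequences live on ℕ instead of ℤ/p, so that shifts need no reduction;
-- periodicity is carried as a separate hypothesis.
Δ : ℕ → (ℕ → ℚ) → ℕ → ℚ
Δ a f i = f i - f (a ℕ.+ i)

Δs : List ℕ → (ℕ → ℚ) → ℕ → ℚ
Δs L f = foldr Δ f L

Δ-cong : ∀ a {f g} → (∀ i → f i ≡ g i) → ∀ i → Δ a f i ≡ Δ a g i
Δ-cong a f≗g i = cong₂ _-_ (f≗g i) (f≗g (a ℕ.+ i))

Δ-comm : ∀ a b f i → Δ a (Δ b f) i ≡ Δ b (Δ a f) i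
Δ-comm a b f i = begin
  (f i - f (b ℕ.+ i)) - (f (a ℕ.+ i) - f (b ℕ.+ (a ℕ.+ i)))
    ≡⟨ cong (λ m → (f i - f (b ℕ.+ i)) - (f (a ℕ.+ i) - f m)) (+-swapˡ b a i) ⟩
  (f i - f (b ℕ.+ i)) - (f (a ℕ.+ i) - f (a ℕ.+ (b ℕ.+ i)))
    ≡⟨ solve 4 (λ x y z w → (x :- y) :- (z :- w) := (x :- z) :- (y :- w)) ≡.refl
         (f i) (f (b ℕ.+ i)) (f (a ℕ.+ i)) (f (a ℕ.+ (b ℕ.+ i))) ⟩
  (f i - f (a ℕ.+ i)) - (f (b ℕ.+ i) - f (a ℕ.+ (b ℕ.+ i))) ∎
  where
  open ≡-Reasoning
  open +-*-Solver

Δs-↭ : ∀ {L K} → L ↭ K → ∀ f i → Δs L f i ≡ Δs K f i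
Δs-↭ refl                   f i = ≡.refl
Δs-↭ (prep a L↭K)           f i = Δ-cong a (Δs-↭ L↭K f) i
Δs-↭ (swap {xs = L} a b L↭K) f i =
  ≡.trans (Δ-comm a b (Δs L f) i) (Δ-cong b (Δ-cong a (Δs-↭ L↭K f)) i)
Δs-↭ (trans L↭K K↭J)        f i = ≡.trans (Δs-↭ L↭K f i) (Δs-↭ K↭J f i)

Δ-periodic : ∀ {p f} a → Periodic p f → Periodic p (Δ a f)
Δ-periodic {p} {f} a per i = cong₂ _-_ (per i)
  (≡.trans (cong f (+-swapˡ a p i)) (per (a ℕ.+ i)))

Δs-periodic : ∀ {p f} L → Periodic p f → Periodic p (Δs L f)
Δs-periodic []      per = per
Δs-periodic (a ∷ L) per = Δ-periodic a (Δs-periodic L per)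

-- Used to replace the shifts 2ᵐ by their residues, which are at most p, so that `p ∸ a` is a
-- genuine negation modulo p.
Δs-% : ∀ {p f} .{{_ : NonZero p}} → Periodic p f → ∀ L i → Δs (map (_% p) L) f i ≡ Δs L f i
Δs-%             per []      i = ≡.refl
Δs-% {p} {f} per (a ∷ L) i = cong₂ _-_ (Δs-% per L i)
  (≡.trans (Δs-% per L (a % p ℕ.+ i)) (periodic-% (Δs-periodic L per) a i))

-- Inner product over one period

⟨_,_⟩[_] : (ℕ → ℚ) → (ℕ → ℚ) → ℕ → ℚ
⟨ f , g ⟩[ p ] = Σ< p (λ i → f i * g i)

-- A full period may be summed from any starting point, so the adjoint of Tᵃ is its inverse, which
-- is the shift by p - a.
Δ-adjoint : ∀ {p f g a} → Periodic p f → Periodic p g → a ℕ.≤ p →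
            ⟨ Δ a f , g ⟩[ p ] ≡ ⟨ f , Δ (p ℕ.∸ a) g ⟩[ p ]
Δ-adjoint {p} {f} {g} {a} perf perg a≤p = begin
  Σ< p (λ i → (f i - f (a ℕ.+ i)) * g i)
    ≡⟨ Σ<-cong p (λ i → solve 3 (λ x y z → (x :- y) :* z := x :* z :- y :* z) ≡.refl
         (f i) (f (a ℕ.+ i)) (g i)) ⟩
  Σ< p (λ i → f i * g i - f (a ℕ.+ i) * g i)
    ≡⟨ sum-distrib-minus {p} _ _ ⟩
  ⟨ f , g ⟩[ p ] - Σ< p (λ i → f (a ℕ.+ i) * g i)
    ≡⟨ cong (λ x → ⟨ f , g ⟩[ p ] - x) shifted ⟩
  ⟨ f , g ⟩[ p ] - Σ< p (λ i → f i * g (b ℕ.+ i))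
    ≡⟨ sum-distrib-minus {p} _ _ ⟨
  Σ< p (λ i → f i * g i - f i * g (b ℕ.+ i))
    ≡⟨ Σ<-cong p (λ i → solve 3 (λ x y z → x :* y :- x :* z := x :* (y :- z)) ≡.refl
         (f i) (g i) (g (b ℕ.+ i))) ⟩
  Σ< p (λ i → f i * (g i - g (b ℕ.+ i))) ∎
  where
  open ≡-Reasoning
  open +-*-Solver
  b = p ℕ.∸ a
  a+b : ∀ i → a ℕ.+ (b ℕ.+ i) ≡ p ℕ.+ i
  a+b i = ≡.trans (≡.sym (ℕ.+-assoc a b i)) (cong (ℕ._+ i) (ℕ.m+[n∸m]≡n a≤p))
  per : Periodic p (λ i → f (a ℕ.+ i) * g i)
  per i = cong₂ _*_ (≡.trans (cong f (+-swapˡ a p i)) (perf (a ℕ.+ i))) (perg i)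
  shifted : Σ< p (λ i → f (a ℕ.+ i) * g i) ≡ Σ< p (λ i → f i * g (b ℕ.+ i))
  shifted = ≡.trans (≡.sym (Σ<-shift p per b))
    (Σ<-cong p (λ i → cong (_* g (b ℕ.+ i)) (≡.trans (cong f (a+b i)) (perf i))))

Δs-∷ʳ : ∀ L a f i → Δs L (Δ a f) i ≡ Δ a (Δs L f) i
Δs-∷ʳ L a f i = ≡.trans
  (cong (_$ i) (≡.sym (List.foldr-++ Δ f L (a ∷ []))))
  (Δs-↭ (↭-sym (↭.∷↭∷ʳ a L)) f i)

Δs-adjoint : ∀ {p f g} → Periodic p f → Periodic p g → ∀ {L} → All (ℕ._≤ p) L →
             ⟨ Δs L f , g ⟩[ p ] ≡ ⟨ f , Δs (map (p ℕ.∸_) L) g ⟩[ p ]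
Δs-adjoint perf perg [] = ≡.refl
Δs-adjoint {p} {f} {g} perf perg {a ∷ L} (a≤p ∷ L≤p) = begin
  ⟨ Δ a (Δs L f) , g ⟩[ p ]
    ≡⟨ Δ-adjoint (Δs-periodic L perf) perg a≤p ⟩
  ⟨ Δs L f , Δ (p ℕ.∸ a) g ⟩[ p ]
    ≡⟨ Δs-adjoint perf (Δ-periodic (p ℕ.∸ a) perg) L≤p ⟩
  ⟨ f , Δs (map (p ℕ.∸_) L) (Δ (p ℕ.∸ a) g) ⟩[ p ]
    ≡⟨ Σ<-cong p (λ i → cong (f i *_) (Δs-∷ʳ (map (p ℕ.∸_) L) (p ℕ.∸ a) g i)) ⟩
  ⟨ f , Δs (map (p ℕ.∸_) (a ∷ L)) g ⟩[ p ] ∎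
  where open ≡-Reasoning

-- The coefficient of yᵏ in ∏_{a ∈ L} (1 − y Tᵃ), where (T f) i = f (1 + i).
esym : List ℕ → ℕ → (ℕ → ℚ) → ℕ → ℚ
esym L       zero    f i = f i
esym []      (suc k) f i = 0ℚ
esym (a ∷ L) (suc k) f i = esym L (suc k) f i - esym L k f (a ℕ.+ i)

esym-periodic : ∀ {p f} → Periodic p f → ∀ L k → Periodic p (esym L k f)
esym-periodic per L       zero    i = per i
esym-periodic per []      (suc k) i = ≡.refl
esym-periodic {p} {f} per (a ∷ L) (suc k) i = cong₂ _-_ (esym-periodic per L (suc k) i)
  (≡.trans (cong (esym L k f) (+-swapˡ a p i)) (esym-periodic per L k (a ℕ.+ i)))

-- The recursion of `esym` removes the first factor; removing the last one is what lets the final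
-- shift p in 1, ..., p be traded for 0.
esym-∷ʳ : ∀ L b k f i → esym (L ∷ʳ b) (suc k) f i ≡ esym L (suc k) f i - esym L k f (b ℕ.+ i)
esym-∷ʳ []      b zero    f i = ≡.refl
esym-∷ʳ []      b (suc k) f i = ≡.refl
esym-∷ʳ (a ∷ L) b zero    f i = begin
  esym (L ∷ʳ b) 1 f i - f (a ℕ.+ i)
    ≡⟨ cong (_- f (a ℕ.+ i)) (esym-∷ʳ L b 0 f i) ⟩
  (esym L 1 f i - f (b ℕ.+ i)) - f (a ℕ.+ i)
    ≡⟨ solve 3 (λ x y z → (x :- y) :- z := (x :- z) :- y) ≡.refl (esym L 1 f i) (f (b ℕ.+ i)) (f (a ℕ.+ i)) ⟩
  (esym L 1 f i - f (a ℕ.+ i)) - f (b ℕ.+ i) ∎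
  where open ≡-Reasoning; open +-*-Solver
esym-∷ʳ (a ∷ L) b (suc k) f i = begin
  esym (L ∷ʳ b) (suc (suc k)) f i - esym (L ∷ʳ b) (suc k) f (a ℕ.+ i)
    ≡⟨ cong₂ _-_ (esym-∷ʳ L b (suc k) f i) (esym-∷ʳ L b k f (a ℕ.+ i)) ⟩
  (e₂ i - e₁ (b ℕ.+ i)) - (e₁ (a ℕ.+ i) - e₀ (b ℕ.+ (a ℕ.+ i)))
    ≡⟨ cong (λ m → (e₂ i - e₁ (b ℕ.+ i)) - (e₁ (a ℕ.+ i) - e₀ m)) (+-swapˡ b a i) ⟩
  (e₂ i - e₁ (b ℕ.+ i)) - (e₁ (a ℕ.+ i) - e₀ (a ℕ.+ (b ℕ.+ i)))
    ≡⟨ solve 4 (λ x y z w → (x :- y) :- (z :- w) := (x :- z) :- (y :- w)) ≡.refl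
         (e₂ i) (e₁ (b ℕ.+ i)) (e₁ (a ℕ.+ i)) (e₀ (a ℕ.+ (b ℕ.+ i))) ⟩
  (e₂ i - e₁ (a ℕ.+ i)) - (e₁ (b ℕ.+ i) - e₀ (a ℕ.+ (b ℕ.+ i))) ∎
  where
  open ≡-Reasoning
  open +-*-Solver
  e₀ = esym L k f
  e₁ = esym L (suc k) f
  e₂ = esym L (suc (suc k)) f

-- Homogeneity of degree k in the Tᵃ.
esym-map-suc : ∀ L k f i → esym (map suc L) k f i ≡ esym L k f (k ℕ.+ i)
esym-map-suc L       zero    f i = ≡.refl
esym-map-suc []      (suc k) f i = ≡.refl
esym-map-suc (a ∷ L) (suc k) f i = cong₂ _-_ (esym-map-suc L (suc k) f i)
  (≡.trans (esym-map-suc L k f (suc a ℕ.+ i)) (cong (esym L k f) (move a k i)))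
  where
  move : ∀ a k i → k ℕ.+ (suc a ℕ.+ i) ≡ a ℕ.+ (suc k ℕ.+ i)
  move = ℕSolver.solve-∀

-- Evaluation at y = 1.
Δs-esym : ∀ L {N} → length L ℕ.< N → ∀ f i → Δs L f i ≡ Σ< N (λ k → esym L k f i)
Δs-esym []      {suc N} _ f i = ≡.sym (≡.trans (cong (f i ℚ.+_) (zeros N)) (ℚ.+-identityʳ (f i)))
  where
  zeros : ∀ N → Σ< N (λ k → 0ℚ) ≡ 0ℚ
  zeros zero    = ≡.refl
  zeros (suc N) = ≡.trans (ℚ.+-identityˡ _) (zeros N)
Δs-esym (a ∷ L) {suc N} (s≤s L<N) f i = begin
  Δs L f i - Δs L f (a ℕ.+ i)
    ≡⟨ cong₂ _-_ (Δs-esym L (ℕ.m<n⇒m<1+n L<N) f i) (Δs-esym L L<N f (a ℕ.+ i)) ⟩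
  (f i + Σ< N (λ k → esym L (suc k) f i)) - Σ< N (λ k → esym L k f (a ℕ.+ i))
    ≡⟨ ℚ.+-assoc (f i) _ _ ⟩
  f i + (Σ< N (λ k → esym L (suc k) f i) - Σ< N (λ k → esym L k f (a ℕ.+ i)))
    ≡⟨ cong (f i ℚ.+_) (sum-distrib-minus {N} _ _) ⟨
  f i + Σ< N (λ k → esym L (suc k) f i - esym L k f (a ℕ.+ i)) ∎
  where open ≡-Reasoning

-- By Bézout some multiple of one period exceeds a multiple of the other by 1, so 1 is a period as
-- well.
coprime-periods⇒constant : ∀ {p k f} → Coprime k p → Periodic p f → Periodic k f → ∀ i → f i ≡ f 0
coprime-periods⇒constant {p} {k} {f} cop perp perk zero    = ≡.refl
coprime-periods⇒constant {p} {k} {f} cop perp perk (suc i) =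
  ≡.trans (step (coprime-Bézout cop)) (coprime-periods⇒constant cop perp perk i)
  where
  open ≡-Reasoning
  step : Bézout.Identity 1 k p → f (suc i) ≡ f i
  step (Bézout.Identity.+- x y eq) = begin
    f (suc i)                        ≡⟨ periodic-* perp y (suc i) ⟨
    f (y ℕ.* p ℕ.+ suc i)            ≡⟨ cong f (ℕ.+-suc (y ℕ.* p) i) ⟩
    f (1 ℕ.+ y ℕ.* p ℕ.+ i)          ≡⟨ cong (λ m → f (m ℕ.+ i)) eq ⟩
    f (x ℕ.* k ℕ.+ i)                ≡⟨ periodic-* perk x i ⟩
    f i                              ∎
  step (Bézout.Identity.-+ x y eq) = begin
    f (suc i)                        ≡⟨ periodic-* perk x (suc i) ⟨
    f (x ℕ.* k ℕ.+ suc i)            ≡⟨ cong f (ℕ.+-suc (x ℕ.* k) i) ⟩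
    f (1 ℕ.+ x ℕ.* k ℕ.+ i)          ≡⟨ cong (λ m → f (m ℕ.+ i)) eq ⟩
    f (y ℕ.* p ℕ.+ i)                ≡⟨ periodic-* perp y i ⟩
    f i                              ∎

-- Multiplying every Tᵃ, a ∈ ℤ/p, by T permutes them, so their k-th elementary
-- symmetric function is invariant under Tᵏ.
esym-upTo-constant : ∀ n {f} → Periodic (suc n) f → ∀ k → Coprime (suc k) (suc n) →
                     ∀ i → esym (upTo (suc n)) (suc k) f i ≡ esym (upTo (suc n)) (suc k) f 0
esym-upTo-constant n {f} per k cop =
  coprime-periods⇒constant cop (esym-periodic per (upTo (suc n)) (suc k)) λ i → begin
    esym (upTo (suc n)) (suc k) f (suc k ℕ.+ i)
      ≡⟨ esym-map-suc (upTo (suc n)) (suc k) f i ⟨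
    esym (map suc (upTo (suc n))) (suc k) f i
      ≡⟨ cong (λ L → esym L (suc k) f i) (List.map-upTo suc (suc n)) ⟩
    esym (applyUpTo suc (suc n)) (suc k) f i
      ≡⟨ cong (λ L → esym L (suc k) f i) (List.applyUpTo-∷ʳ suc n) ⟨
    esym (applyUpTo suc n ∷ʳ suc n) (suc k) f i
      ≡⟨ esym-∷ʳ (applyUpTo suc n) (suc n) k f i ⟩
    esym (applyUpTo suc n) (suc k) f i - esym (applyUpTo suc n) k f (suc n ℕ.+ i)
      -- Modulo the period the last shift `suc n` is the shift by 0, which is the head of
      -- `upTo (suc n)`.
      ≡⟨ cong (esym (applyUpTo suc n) (suc k) f i -_) (esym-periodic per (applyUpTo suc n) k i) ⟩
    esym (upTo (suc n)) (suc k) f i ∎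
  where open ≡-Reasoning

-- The head 0 of `upTo (suc n)` contributes the factor 1 - y, so the constant sequences of
-- `esym-upTo-constant` are differences of consecutive coefficients here. Up to constants, all these
-- coefficients equal the one of degree zero, which is `f`.
esym-nonzero-residues : ∀ n {f} → Periodic (suc n) f →
  (∀ k → k ℕ.< n → Coprime (suc k) (suc n)) → ∀ k → k ℕ.≤ n → ∀ i →
  esym (applyUpTo suc n) k f i - esym (applyUpTo suc n) k f 0 ≡ f i - f 0
esym-nonzero-residues n     per cop zero    _   i = ≡.refl
esym-nonzero-residues n {f} per cop (suc k) k<n i = begin
  e₁ i - e₁ 0
    ≡⟨ solve 4 (λ a b c d → a :- b := ((a :- c) :- (b :- d)) :+ (c :- d)) ≡.refl
         (e₁ i) (e₁ 0) (e₀ i) (e₀ 0) ⟩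
  ((e₁ i - e₀ i) - (e₁ 0 - e₀ 0)) + (e₀ i - e₀ 0)
    ≡⟨ cong₂ (λ a b → (a - (e₁ 0 - e₀ 0)) + b) (esym-upTo-constant n per k (cop k k<n) i)
         (esym-nonzero-residues n per cop k (ℕ.<⇒≤ k<n) i) ⟩
  ((e₁ 0 - e₀ 0) - (e₁ 0 - e₀ 0)) + (f i - f 0)
    ≡⟨ solve 2 (λ a b → (a :- a) :+ b := b) ≡.refl (e₁ 0 - e₀ 0) (f i - f 0) ⟩
  f i - f 0 ∎
  where
  open ≡-Reasoning
  open +-*-Solver
  e₀ = esym (applyUpTo suc n) k f
  e₁ = esym (applyUpTo suc n) (suc k) f

Σ<-const : ∀ n x → Σ< n (λ _ → x) ≡ Σ< n (λ _ → 1ℚ) * x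
Σ<-const n x = ≡.trans (Σ<-cong n (λ _ → ≡.sym (ℚ.*-identityˡ x)))
  (≡.sym (*-distribʳ-sum {n} x (λ _ → 1ℚ)))

Σ<-cong-< : ∀ n {f g} → (∀ i → i ℕ.< n → f i ≡ g i) → Σ< n f ≡ Σ< n g
Σ<-cong-< n f≗g = sum-cong-≗ {n} (λ i → f≗g (toℕ i) (Fin.toℕ<n i))

-- At y = 1 the p coefficients, of degrees 0 to p - 1, contribute `f i - f 0` each.
Δs-nonzero-residues : ∀ n {f} → Periodic (suc n) f →
  (∀ k → k ℕ.< n → Coprime (suc k) (suc n)) → ∀ i →
  Δs (applyUpTo suc n) f i - Δs (applyUpTo suc n) f 0 ≡ Σ< (suc n) (λ _ → 1ℚ) * (f i - f 0)
Δs-nonzero-residues n {f} per cop i = begin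
  Δs L f i - Δs L f 0
    ≡⟨ cong₂ _-_ (Δs-esym L L<p f i) (Δs-esym L L<p f 0) ⟩
  Σ< (suc n) (λ k → esym L k f i) - Σ< (suc n) (λ k → esym L k f 0)
    ≡⟨ sum-distrib-minus {suc n} (λ k → esym L (toℕ k) f i) (λ k → esym L (toℕ k) f 0) ⟨
  Σ< (suc n) (λ k → esym L k f i - esym L k f 0)
    ≡⟨ Σ<-cong-< (suc n) (λ k k<p → esym-nonzero-residues n per cop k (ℕ.s≤s⁻¹ k<p) i) ⟩
  Σ< (suc n) (λ k → f i - f 0)
    ≡⟨ Σ<-const (suc n) (f i - f 0) ⟩
  Σ< (suc n) (λ _ → 1ℚ) * (f i - f 0) ∎
  where
  open ≡-Reasoning
  L = applyUpTo suc n
  L<p : length L ℕ.< suc n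
  L<p = ℕ.≤-reflexive (cong suc (List.length-applyUpTo suc n))

-- Powers of 2 modulo p

-- Pigeonhole: each element of `xs` is struck from `ys`, and the lengths leave nothing over. Thanks
-- to this, no explicit exponent and sign has to be found for a given nonzero residue.
unique⊆⇒↭ : ∀ {A : Set} {xs ys : List A} →
            Unique xs → xs ⊆ ys → length ys ℕ.≤ length xs → xs ↭ ys
unique⊆⇒↭ {ys = []} [] _ _ = refl
unique⊆⇒↭ {xs = x ∷ xs} {ys} (x∉xs ∷ uxs) xs⊆ys ys≤xs with ∈-∃++ (xs⊆ys (here ≡.refl))
... | as , bs , ≡.refl = trans (prep x (unique⊆⇒↭ uxs xs⊆ shorter)) (↭-sym (↭.shift x as bs))
  where
  xs⊆ : xs ⊆ as ++ bs
  xs⊆ {y} y∈xs with ∈-++⁻ as (xs⊆ys (there y∈xs))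
  ... | inj₁ y∈as          = ∈-++⁺ˡ y∈as
  ... | inj₂ (here ≡.refl) = contradiction ≡.refl (All.lookup x∉xs y∈xs)
  ... | inj₂ (there y∈bs)  = ∈-++⁺ʳ as y∈bs
  shorter : length (as ++ bs) ℕ.≤ length xs
  shorter = ℕ.s≤s⁻¹ (subst (ℕ._≤ suc (length xs)) (↭.↭-length (↭.shift x as bs)) ys≤xs)

mod-refl : ∀ {p a} → a ≡ a [mod p ]
mod-refl {p} {a} = divides 0ℤ (ℤ.+-inverseʳ a)

mod-* : ∀ {p a b c d} → a ≡ b [mod p ] → c ≡ d [mod p ] → a ℤ.* c ≡ b ℤ.* d [mod p ]
mod-* {p} {a} {b} {c} {d} a≡b c≡d = subst (+ p ∣_) (regroup a b c d)
  (∣m∣n⇒∣m+n (∣n⇒∣m*n a c≡d) (∣m⇒∣m*n d a≡b))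
  where
  regroup : ∀ a b c d → a ℤ.* (c ℤ.- d) ℤ.+ (a ℤ.- b) ℤ.* d ≡ a ℤ.* c ℤ.- b ℤ.* d
  regroup = ℤSolver.solve-∀

mod-^ : ∀ {p a b} n → a ≡ b [mod p ] → a ℤ.^ n ≡ b ℤ.^ n [mod p ]
mod-^ {p} zero _ = mod-refl {p} {1ℤ}
mod-^ {p} {a} {b} (suc n) a≡b = mod-* {p} {a} {b} {a ℤ.^ n} {b ℤ.^ n} a≡b (mod-^ n a≡b)

pos-^ : ∀ m n → + (m ℕ.^ n) ≡ (+ m) ℤ.^ n
pos-^ m zero    = ≡.refl
pos-^ m (suc n) = ≡.trans (ℤ.pos-* m (m ℕ.^ n)) (cong ((+ m) ℤ.*_) (pos-^ m n))

%-≡⇒mod : ∀ {p} .{{_ : NonZero p}} a b → a % p ≡ b % p → + a ≡ + b [mod p ]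
%-≡⇒mod {p} a b eq = divides (+ (a / p) ℤ.- + (b / p)) $ begin
  + a ℤ.- + b
    ≡⟨ cong₂ ℤ._-_ (split a) (split b) ⟩
  (+ (a % p) ℤ.+ + (a / p) ℤ.* + p) ℤ.- (+ (b % p) ℤ.+ + (b / p) ℤ.* + p)
    ≡⟨ cong (λ r → (+ r ℤ.+ + (a / p) ℤ.* + p) ℤ.- (+ (b % p) ℤ.+ + (b / p) ℤ.* + p)) eq ⟩
  (+ (b % p) ℤ.+ + (a / p) ℤ.* + p) ℤ.- (+ (b % p) ℤ.+ + (b / p) ℤ.* + p)
    ≡⟨ cancel (+ (b % p)) (+ (a / p)) (+ (b / p)) (+ p) ⟩
  (+ (a / p) ℤ.- + (b / p)) ℤ.* + p ∎
  where
  open ≡-Reasoning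
  split : ∀ a → + a ≡ + (a % p) ℤ.+ + (a / p) ℤ.* + p
  split a = ≡.trans (cong +_ (m≡m%n+[m/n]*n a p))
    (≡.trans (ℤ.pos-+ (a % p) (a / p ℕ.* p)) (cong (λ z → + (a % p) ℤ.+ z) (ℤ.pos-* (a / p) p)))
  cancel : ∀ r x y q → (r ℤ.+ x ℤ.* q) ℤ.- (r ℤ.+ y ℤ.* q) ≡ (x ℤ.- y) ℤ.* q
  cancel = ℤSolver.solve-∀

%-+≡⇒∣ : ∀ {p} .{{_ : NonZero p}} a b → a % p ℕ.+ b % p ≡ p → + p ∣ + a ℤ.+ + b
%-+≡⇒∣ {p} a b eq = ∣ᵤ⇒∣ {i = + (a ℕ.+ b)} (ℕ.divides (suc (a / p ℕ.+ b / p)) (begin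
  a ℕ.+ b
    ≡⟨ cong₂ ℕ._+_ (m≡m%n+[m/n]*n a p) (m≡m%n+[m/n]*n b p) ⟩
  (a % p ℕ.+ a / p ℕ.* p) ℕ.+ (b % p ℕ.+ b / p ℕ.* p)
    ≡⟨ regroup (a % p) (a / p) (b % p) (b / p) p ⟩
  (a % p ℕ.+ b % p) ℕ.+ (a / p ℕ.+ b / p) ℕ.* p
    ≡⟨ cong (ℕ._+ (a / p ℕ.+ b / p) ℕ.* p) eq ⟩
  suc (a / p ℕ.+ b / p) ℕ.* p ∎))
  where
  open ≡-Reasoning
  regroup : ∀ r x t y p → (r ℕ.+ x ℕ.* p) ℕ.+ (t ℕ.+ y ℕ.* p) ≡ (r ℕ.+ t) ℕ.+ (x ℕ.+ y) ℕ.* p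
  regroup = ℕSolver.solve-∀

odd-prime∤2^ : ∀ {p} → Prime p → p ≢ 2 → ∀ n → ¬ p ℕ.∣ 2 ℕ.^ n
odd-prime∤2^ {p} pr p≢2 zero    p∣1 =
  contradiction (ℕ.∣1⇒≡1 p∣1) (ℕ.nonTrivial⇒≢1 {{prime⇒nonTrivial pr}})
odd-prime∤2^ {p} pr p≢2 (suc n) p∣ with euclidsLemma 2 (2 ℕ.^ n) pr p∣
... | inj₁ p∣2  = p≢2 (ℕ.≤-antisym (ℕ.∣⇒≤ p∣2) (ℕ.nonTrivial⇒n>1 p {{prime⇒nonTrivial pr}}))
... | inj₂ p∣2ⁿ = odd-prime∤2^ pr p≢2 n p∣2ⁿ

private
  sq-^ : ∀ x t → x ℤ.^ suc (2 ℕ.* t) ≡ x ℤ.* (x ℤ.* x) ℤ.^ t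
  sq-^ x t = cong (x ℤ.*_) (≡.trans (≡.sym (ℤ.^-*-assoc x 2 t)) (cong (λ y → (x ℤ.* y) ℤ.^ t) (ℤ.^-identityʳ x)))

  *-cancel-2^ : ∀ {p} → Prime p → p ≢ 2 → ∀ a {d} → + p ∣ + (2 ℕ.^ a) ℤ.* d → + p ∣ d
  *-cancel-2^ {p} pr p≢2 a {d} p∣ with euclidsLemma (2 ℕ.^ a) ℤ.∣ d ∣ pr
    (subst (p ℕ.∣_) (ℤ.abs-* (+ (2 ℕ.^ a)) d) (∣⇒∣ᵤ p∣))
  ... | inj₁ p∣2ᵃ = contradiction p∣2ᵃ (odd-prime∤2^ pr p≢2 a)
  ... | inj₂ p∣d  = ∣ᵤ⇒∣ p∣d

-- The difference is 2ᵃ (2ᵇ⁻ᵃ - 1); the odd prime p cannot divide 2ᵃ, and dividing the other factor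
-- would contradict the minimality of the order.
2^-incongruent : ∀ {p s} → Prime p → p ≢ 2 → IsOrderOf2 p s → ∀ {a b} → a ℕ.< b → b ℕ.< s →
                 ¬ + (2 ℕ.^ b) ≡ + (2 ℕ.^ a) [mod p ]
2^-incongruent {p} {s} pr p≢2 (_ , _ , least) {a} {b} a<b b<s p∣ =
  ℕ.<⇒≱ (ℕ.≤-<-trans (ℕ.m∸n≤m b a) b<s)
    (least (b ℕ.∸ a) (ℕ.m<n⇒0<n∸m a<b) (*-cancel-2^ pr p≢2 a (subst (+ p ∣_) eq p∣)))
  where
  open ≡-Reasoning
  factor : ∀ x y → x ℤ.* y ℤ.- x ≡ x ℤ.* (y ℤ.- 1ℤ)
  factor = ℤSolver.solve-∀
  eq : + (2 ℕ.^ b) ℤ.- + (2 ℕ.^ a) ≡ + (2 ℕ.^ a) ℤ.* (+ (2 ℕ.^ (b ℕ.∸ a)) ℤ.- + 1)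
  eq = begin
    + (2 ℕ.^ b) ℤ.- + (2 ℕ.^ a)
      ≡⟨ cong (λ n → + (2 ℕ.^ n) ℤ.- + (2 ℕ.^ a)) (ℕ.m+[n∸m]≡n (ℕ.<⇒≤ a<b)) ⟨
    + (2 ℕ.^ (a ℕ.+ (b ℕ.∸ a))) ℤ.- + (2 ℕ.^ a)
      ≡⟨ cong (λ n → + n ℤ.- + (2 ℕ.^ a)) (ℕ.^-distribˡ-+-* 2 a (b ℕ.∸ a)) ⟩
    + (2 ℕ.^ a ℕ.* 2 ℕ.^ (b ℕ.∸ a)) ℤ.- + (2 ℕ.^ a)
      ≡⟨ cong (ℤ._- + (2 ℕ.^ a)) (ℤ.pos-* (2 ℕ.^ a) (2 ℕ.^ (b ℕ.∸ a))) ⟩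
    + (2 ℕ.^ a) ℤ.* + (2 ℕ.^ (b ℕ.∸ a)) ℤ.- + (2 ℕ.^ a)
      ≡⟨ factor (+ (2 ℕ.^ a)) (+ (2 ℕ.^ (b ℕ.∸ a))) ⟩
    + (2 ℕ.^ a) ℤ.* (+ (2 ℕ.^ (b ℕ.∸ a)) ℤ.- + 1) ∎

-- Raising 2ᵃ ≡ −2ᵇ to the odd power s would give 1 ≡ −1.
2^-not-opposite : ∀ {p t} → Prime p → p ≢ 2 → + (2 ℕ.^ suc (2 ℕ.* t)) ≡ + 1 [mod p ] →
                  ∀ a b → ¬ + p ∣ + (2 ℕ.^ a) ℤ.+ + (2 ℕ.^ b)
2^-not-opposite {p} {t} pr p≢2 2ˢ≡1 a b p∣ = odd-prime∤2^ pr p≢2 1 (∣⇒∣ᵤ p∣2)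
  where
  s = suc (2 ℕ.* t)
  x = + (2 ℕ.^ a)
  y = + (2 ℕ.^ b)
  one : ∀ c → (+ (2 ℕ.^ c)) ℤ.^ s ≡ + 1 [mod p ]
  one c = subst (λ z → z ≡ + 1 [mod p ]) eq
    (subst (λ z → (+ (2 ℕ.^ s)) ℤ.^ c ≡ z [mod p ]) (ℤ.^-zeroˡ c) (mod-^ c 2ˢ≡1))
    where
    open ≡-Reasoning
    eq : (+ (2 ℕ.^ s)) ℤ.^ c ≡ (+ (2 ℕ.^ c)) ℤ.^ s
    eq = begin
      (+ (2 ℕ.^ s)) ℤ.^ c   ≡⟨ pos-^ (2 ℕ.^ s) c ⟨
      + ((2 ℕ.^ s) ℕ.^ c) ≡⟨ cong +_ (ℕ.^-*-assoc 2 s c) ⟩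
      + (2 ℕ.^ (s ℕ.* c)) ≡⟨ cong (λ n → + (2 ℕ.^ n)) (ℕ.*-comm s c) ⟩
      + (2 ℕ.^ (c ℕ.* s)) ≡⟨ cong +_ (ℕ.^-*-assoc 2 c s) ⟨
      + ((2 ℕ.^ c) ℕ.^ s) ≡⟨ pos-^ (2 ℕ.^ c) s ⟩
      (+ (2 ℕ.^ c)) ℤ.^ s ∎
  factor : ∀ x y → (x ℤ.+ y) ℤ.* (x ℤ.- y) ≡ x ℤ.* x ℤ.- y ℤ.* y
  factor = ℤSolver.solve-∀
  squares : x ℤ.* x ≡ y ℤ.* y [mod p ]
  squares = subst (+ p ∣_) (factor x y) (∣m⇒∣m*n (x ℤ.- y) p∣)
  regroup : ∀ x y u v → (x ℤ.+ y) ℤ.* u ℤ.- y ℤ.* (u ℤ.- v) ≡ x ℤ.* u ℤ.+ y ℤ.* v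
  regroup = ℤSolver.solve-∀
  -- With s = 2t + 1, the sum is (x + y) (x²)ᵗ - y ((x²)ᵗ - (y²)ᵗ), and both terms are divisible by
  -- p because x² ≡ y².
  p∣xˢ+yˢ : + p ∣ x ℤ.^ s ℤ.+ y ℤ.^ s
  p∣xˢ+yˢ = subst (+ p ∣_) (≡.sym (cong₂ ℤ._+_ (sq-^ x t) (sq-^ y t)))
    (subst (+ p ∣_) (regroup x y ((x ℤ.* x) ℤ.^ t) ((y ℤ.* y) ℤ.^ t))
      (∣m∣n⇒∣m-n (∣m⇒∣m*n ((x ℤ.* x) ℤ.^ t) p∣) (∣n⇒∣m*n y (mod-^ t squares))))
  two : ∀ u v → (u ℤ.+ v) ℤ.- ((u ℤ.- + 1) ℤ.+ (v ℤ.- + 1)) ≡ + 2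
  two = ℤSolver.solve-∀
  p∣2 : + p ∣ + 2
  p∣2 = subst (+ p ∣_) (two (x ℤ.^ s) (y ℤ.^ s))
    (∣m∣n⇒∣m-n p∣xˢ+yˢ (∣m∣n⇒∣m+n (one a) (one b)))

-- The 2s = p − 1 residues ±2ᵐ, m < s, are nonzero and pairwise distinct.
±2^-residues-↭ : ∀ {n t} → Prime (suc n) → suc n ≢ 2 → let s = suc (2 ℕ.* t) in
  n ≡ s ℕ.+ s → IsOrderOf2 (suc n) s →
  let L = applyUpTo (λ m → 2 ℕ.^ m % suc n) s in
  map (suc n ℕ.∸_) L ++ L ↭ applyUpTo suc n
±2^-residues-↭ {n} {t} pr p≢2 n≡s+s ord@(_ , 2ˢ≡1 , _) =
  unique⊆⇒↭ unique subset (ℕ.≤-reflexive lengths)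
  where
  p = suc n
  s = suc (2 ℕ.* t)
  r : ℕ → ℕ
  r m = 2 ℕ.^ m % p
  L = applyUpTo r s
  map-L : map (p ℕ.∸_) L ≡ applyUpTo (λ m → p ℕ.∸ r m) s
  map-L = List.map-applyUpTo r (p ℕ.∸_) s
  r≢0 : ∀ m → r m ≢ 0
  r≢0 m r≡0 = odd-prime∤2^ pr p≢2 m (ℕ.m%n≡0⇒n∣m (2 ℕ.^ m) p r≡0)
  r-injective : ∀ {i j} → i ℕ.< j → j ℕ.< s → r i ≢ r j
  r-injective {i} {j} i<j j<s eq =
    2^-incongruent {s = s} pr p≢2 ord i<j j<s (%-≡⇒mod (2 ℕ.^ j) (2 ℕ.^ i) (≡.sym eq))
  disjoint : ∀ {v} → ¬ (v ∈ map (p ℕ.∸_) L × v ∈ L)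
  disjoint {v} (v∈₁ , v∈₂)
    with ∈-applyUpTo⁻ (λ m → p ℕ.∸ r m) (subst (v ∈_) map-L v∈₁) | ∈-applyUpTo⁻ r v∈₂
  ... | a , _ , ≡.refl | b , _ , eq = 2^-not-opposite {t = t} pr p≢2 2ˢ≡1 a b
    (%-+≡⇒∣ (2 ℕ.^ a) (2 ℕ.^ b)
      (≡.trans (cong (r a ℕ.+_) (≡.sym eq)) (ℕ.m+[n∸m]≡n (m%n≤n (2 ℕ.^ a) p))))
  unique : Unique (map (p ℕ.∸_) L ++ L)
  unique = Unique.++⁺
    (subst Unique (≡.sym map-L) (Unique.applyUpTo⁺₁ _ s λ {i} {j} i<j j<s eq →
      r-injective i<j j<s (ℕ.∸-cancelˡ-≡ (m%n≤n (2 ℕ.^ i) p) (m%n≤n (2 ℕ.^ j) p) eq)))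
    (Unique.applyUpTo⁺₁ r s r-injective)
    disjoint
  nonzero-residue : ∀ x → x ≢ 0 → x ℕ.< p → x ∈ applyUpTo suc n
  nonzero-residue zero    x≢0 _   = contradiction ≡.refl x≢0
  nonzero-residue (suc x) _   x<p = ∈-applyUpTo⁺ suc (ℕ.s≤s⁻¹ x<p)
  subset : map (p ℕ.∸_) L ++ L ⊆ applyUpTo suc n
  subset {v} v∈ with ∈-++⁻ (map (p ℕ.∸_) L) v∈
  ... | inj₁ v∈₁ with ∈-applyUpTo⁻ (λ m → p ℕ.∸ r m) (subst (v ∈_) map-L v∈₁)
  ...   | a , _ , ≡.refl = nonzero-residue (p ℕ.∸ r a)
          (ℕ.m>n⇒m∸n≢0 (m%n<n (2 ℕ.^ a) p)) (ℕ.∸-monoʳ-< (ℕ.n≢0⇒n>0 (r≢0 a)) (m%n≤n (2 ℕ.^ a) p))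
  subset {v} v∈ | inj₂ v∈₂ with ∈-applyUpTo⁻ r v∈₂
  ...   | b , _ , ≡.refl = nonzero-residue (r b) (r≢0 b) (m%n<n (2 ℕ.^ b) p)
  lengths : length (applyUpTo suc n) ≡ length (map (p ℕ.∸_) L ++ L)
  lengths = begin
    length (applyUpTo suc n)               ≡⟨ List.length-applyUpTo suc n ⟩
    n                                      ≡⟨ n≡s+s ⟩
    s ℕ.+ s                                ≡⟨ cong₂ ℕ._+_ (List.length-applyUpTo r s) (List.length-applyUpTo r s) ⟨
    length L ℕ.+ length L                  ≡⟨ cong (ℕ._+ length L) (List.length-map (p ℕ.∸_) L) ⟨
    length (map (p ℕ.∸_) L) ℕ.+ length L   ≡⟨ List.length-++ (map (p ℕ.∸_) L) ⟨
    length (map (p ℕ.∸_) L ++ L)           ∎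
    where open ≡-Reasoning

-- Rarefied sums as finite differences

0≤x² : ∀ x → 0ℚ ≤ x * x
0≤x² x with ℚ.≤-total 0ℚ x
... | inj₁ 0≤x = ℚ.nonNegative⁻¹ (x * x) {{ℚ.nonNeg*nonNeg⇒nonNeg x {{ℚ.nonNegative 0≤x}} x {{ℚ.nonNegative 0≤x}}}}
... | inj₂ x≤0 = ℚ.nonNegative⁻¹ (x * x) {{ℚ.nonPos*nonPos⇒nonPos x {{ℚ.nonPositive x≤0}} x {{ℚ.nonPositive x≤0}}}}

Σ<-zero : ∀ n → Σ< n (λ _ → 0ℚ) ≡ 0ℚ
Σ<-zero n = ≡.trans (Σ<-const n 0ℚ) (ℚ.*-zeroʳ (Σ< n (λ _ → 1ℚ)))

ΣΔ≡0 : ∀ p a {f} → Periodic p f → Σ< p (Δ a f) ≡ 0ℚ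
ΣΔ≡0 p a {f} per = begin
  Σ< p (Δ a f)                          ≡⟨ sum-distrib-minus {p} (λ i → f (toℕ i)) (λ i → f (a ℕ.+ toℕ i)) ⟩
  Σ< p f - Σ< p (λ i → f (a ℕ.+ i))     ≡⟨ cong (Σ< p f -_) (Σ<-shift p per a) ⟩
  Σ< p f - Σ< p f                       ≡⟨ ℚ.+-inverseʳ (Σ< p f) ⟩
  0ℚ                                    ∎
  where open ≡-Reasoning

-- ∏_{0 < a ≤ n} (1 − Tᵃ) = p − Σ_{a < p} Tᵃ for p = n + 1.
⟨f,Δs-nonzero-residues⟩ : ∀ n {f} → Periodic (2 ℕ.+ n) f →
  (∀ k → k ℕ.< suc n → Coprime (suc k) (2 ℕ.+ n)) →
  ⟨ f , Δs (applyUpTo suc (suc n)) f ⟩[ 2 ℕ.+ n ] ≡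
  Σ< (2 ℕ.+ n) (λ _ → 1ℚ) * ⟨ f , f ⟩[ 2 ℕ.+ n ] - Σ< (2 ℕ.+ n) f * Σ< (2 ℕ.+ n) f
⟨f,Δs-nonzero-residues⟩ n {f} per cop = begin
  Σ< p (λ i → f i * h i)
    ≡⟨ Σ<-cong p (λ i → ≡.trans (cong (f i *_) (affine i)) (expand (f i) P C)) ⟩
  Σ< p (λ i → P * (f i * f i) + C * f i)
    ≡⟨ ∑-distrib-+ {p} (λ i → P * (f (toℕ i) * f (toℕ i))) (λ i → C * f (toℕ i)) ⟩
  Σ< p (λ i → P * (f i * f i)) + Σ< p (λ i → C * f i)
    ≡⟨ cong₂ _+_ (≡.sym (*-distribˡ-sum {p} P (λ i → f (toℕ i) * f (toℕ i))))
                 (≡.sym (*-distribˡ-sum {p} C (λ i → f (toℕ i)))) ⟩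
  P * ⟨ f , f ⟩[ p ] + C * F
    ≡⟨ cong (λ z → P * ⟨ f , f ⟩[ p ] + z * F) C≡-F ⟩
  P * ⟨ f , f ⟩[ p ] + (0ℚ - F) * F
    ≡⟨ finish (P * ⟨ f , f ⟩[ p ]) F ⟩
  P * ⟨ f , f ⟩[ p ] - F * F ∎
  where
  open ≡-Reasoning
  open +-*-Solver
  p = 2 ℕ.+ n
  h = Δs (applyUpTo suc (suc n)) f
  P = Σ< p (λ _ → 1ℚ)
  F = Σ< p f
  C = h 0 - P * f 0
  expand : ∀ x P C → x * (P * x + C) ≡ P * (x * x) + C * x
  expand = solve 3 (λ x P C → x :* (P :* x :+ C) := P :* (x :* x) :+ C :* x) ≡.refl
  finish : ∀ a F → a + (0ℚ - F) * F ≡ a - F * F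
  finish = solve 2 (λ a F → a :+ (con 0ℚ :- F) :* F := a :- F :* F) ≡.refl
  affine : ∀ i → h i ≡ P * f i + C
  affine i = begin
    h i
      ≡⟨ solve 2 (λ a b → a := (a :- b) :+ b) ≡.refl (h i) (h 0) ⟩
    (h i - h 0) + h 0
      ≡⟨ cong (ℚ._+ h 0) (Δs-nonzero-residues (suc n) per cop i) ⟩
    P * (f i - f 0) + h 0
      ≡⟨ solve 4 (λ P a b c → P :* (a :- b) :+ c := P :* a :+ (c :- P :* b)) ≡.refl P (f i) (f 0) (h 0) ⟩
    P * f i + C ∎
  -- The constant `C` is found by summing over a period: the list starts with the shift 1, so `h` is
  -- a difference and has sum zero.
  P*[F+C]≡0 : P * (F + C) ≡ P * 0ℚ
  P*[F+C]≡0 = begin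
    P * (F + C)                            ≡⟨ ℚ.*-distribˡ-+ P F C ⟩
    P * F + P * C                          ≡⟨ cong₂ _+_ (*-distribˡ-sum {p} P (λ i → f (toℕ i))) (≡.sym (Σ<-const p C)) ⟩
    Σ< p (λ i → P * f i) + Σ< p (λ _ → C)  ≡⟨ ∑-distrib-+ {p} (λ i → P * f (toℕ i)) (λ _ → C) ⟨
    Σ< p (λ i → P * f i + C)               ≡⟨ Σ<-cong p affine ⟨
    Σ< p h                                 ≡⟨ ΣΔ≡0 p 1 (Δs-periodic (applyUpTo (λ i → suc (suc i)) n) per) ⟩
    0ℚ                                     ≡⟨ ℚ.*-zeroʳ P ⟨
    P * 0ℚ                                 ∎
  ones>0 : ∀ n → 0ℚ < Σ< (suc n) (λ _ → 1ℚ)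
  ones>0 zero    = ℚ.positive⁻¹ 1ℚ
  ones>0 (suc n) = ℚ.+-mono-< (ℚ.positive⁻¹ 1ℚ) (ones>0 n)
  instance
    P-pos : ℚ.Positive P
    P-pos = ℚ.positive (ones>0 (suc n))
  C≡-F : C ≡ 0ℚ - F
  C≡-F = ≡.trans (solve 2 (λ C F → C := (F :+ C) :- F) ≡.refl C F)
    (cong (_- F) (ℚ.≤-antisym (ℚ.*-cancelˡ-≤-pos P (ℚ.≤-reflexive P*[F+C]≡0))
                              (ℚ.*-cancelˡ-≤-pos P (ℚ.≤-reflexive (≡.sym P*[F+C]≡0)))))

-- Moving one copy of `Δs L` across the inner product negates its shifts, and the two lists together
-- make up all nonzero residues. The left side is therefore p |f|² - (Σ f)².
Δs-bound : ∀ n {f L} → Periodic (2 ℕ.+ n) f → Prime (2 ℕ.+ n) →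
  All (ℕ._≤ 2 ℕ.+ n) L → map (2 ℕ.+ n ℕ.∸_) L ++ L ↭ applyUpTo suc (suc n) →
  ⟨ Δs L f , Δs L f ⟩[ 2 ℕ.+ n ] ≤ Σ< (2 ℕ.+ n) (λ _ → 1ℚ) * ⟨ f , f ⟩[ 2 ℕ.+ n ]
Δs-bound n {f} {L} per pr L≤p L↭ = begin
  ⟨ Δs L f , Δs L f ⟩[ p ]
    ≡⟨ Δs-adjoint per (Δs-periodic L per) L≤p ⟩
  ⟨ f , Δs (map (p ℕ.∸_) L) (Δs L f) ⟩[ p ]
    ≡⟨ Σ<-cong p (λ i → cong (f i *_) (≡.trans
         (cong (_$ i) (≡.sym (List.foldr-++ Δ f (map (p ℕ.∸_) L) L))) (Δs-↭ L↭ f i))) ⟩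
  ⟨ f , Δs (applyUpTo suc (suc n)) f ⟩[ p ]
    ≡⟨ ⟨f,Δs-nonzero-residues⟩ n per coprime ⟩
  P * ⟨ f , f ⟩[ p ] - F * F
    ≤⟨ ℚ.+-monoʳ-≤ (P * ⟨ f , f ⟩[ p ]) (ℚ.neg-antimono-≤ (0≤x² F)) ⟩
  P * ⟨ f , f ⟩[ p ] - 0ℚ
    ≡⟨ ℚ.+-identityʳ _ ⟩
  P * ⟨ f , f ⟩[ p ] ∎
  where
  open ℚ.≤-Reasoning
  p = 2 ℕ.+ n
  P = Σ< p (λ _ → 1ℚ)
  F = Σ< p f
  coprime : ∀ k → k ℕ.< suc n → Coprime (suc k) p
  coprime k k<n = Coprimality.sym (prime⇒coprime pr (s≤s k<n))

-- Integers inside the rationals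

infix 9 ↑_
↑_ : ℤ → ℚ
↑ i = i ℚ./ 1

toℚᵘ-↑ : ∀ i → toℚᵘ (↑ i) ℚᵘ.≃ mkℚᵘ i 0
toℚᵘ-↑ i = ℚ.toℚᵘ-fromℚᵘ (mkℚᵘ i 0)

-- Rational addition normalises its result, so the identity is checked on unnormalised fractions,
-- where every denominator is 1.
↑-+ : ∀ i j → ↑ (i ℤ.+ j) ≡ ↑ i + ↑ j
↑-+ i j = ℚ.toℚᵘ-injective (begin
  toℚᵘ (↑ (i ℤ.+ j))            ≈⟨ toℚᵘ-↑ (i ℤ.+ j) ⟩
  mkℚᵘ (i ℤ.+ j) 0              ≈⟨ *≡* (eq i j) ⟩
  mkℚᵘ i 0 ℚᵘ.+ mkℚᵘ j 0        ≈⟨ ℚᵘ.+-cong (toℚᵘ-↑ i) (toℚᵘ-↑ j) ⟨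
  toℚᵘ (↑ i) ℚᵘ.+ toℚᵘ (↑ j)    ≈⟨ ℚ.toℚᵘ-homo-+ (↑ i) (↑ j) ⟨
  toℚᵘ (↑ i + ↑ j)              ∎)
  where
  open ℚᵘ.≃-Reasoning
  eq : ∀ i j → (i ℤ.+ j) ℤ.* + 1 ≡ (i ℤ.* + 1 ℤ.+ j ℤ.* + 1) ℤ.* + 1
  eq = ℤSolver.solve-∀

↑-* : ∀ i j → ↑ (i ℤ.* j) ≡ ↑ i * ↑ j
↑-* i j = ℚ.toℚᵘ-injective (begin
  toℚᵘ (↑ (i ℤ.* j))            ≈⟨ toℚᵘ-↑ (i ℤ.* j) ⟩
  mkℚᵘ i 0 ℚᵘ.* mkℚᵘ j 0        ≈⟨ ℚᵘ.*-cong (toℚᵘ-↑ i) (toℚᵘ-↑ j) ⟨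
  toℚᵘ (↑ i) ℚᵘ.* toℚᵘ (↑ j)    ≈⟨ ℚ.toℚᵘ-homo-* (↑ i) (↑ j) ⟨
  toℚᵘ (↑ i * ↑ j)              ∎)
  where open ℚᵘ.≃-Reasoning

↑-neg : ∀ i → ↑ (ℤ.- i) ≡ ℚ.- ↑ i
↑-neg i = ℚ.toℚᵘ-injective (begin
  toℚᵘ (↑ (ℤ.- i))     ≈⟨ toℚᵘ-↑ (ℤ.- i) ⟩
  ℚᵘ.- mkℚᵘ i 0        ≈⟨ ℚᵘ.-‿cong (toℚᵘ-↑ i) ⟨
  ℚᵘ.- toℚᵘ (↑ i)      ≈⟨ ℚ.toℚᵘ-homo‿- (↑ i) ⟨
  toℚᵘ (ℚ.- ↑ i)       ∎)
  where open ℚᵘ.≃-Reasoning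

↑-mono-≤ : ∀ {i j} → i ℤ.≤ j → ↑ i ≤ ↑ j
↑-mono-≤ {i} {j} i≤j = ℚ.toℚᵘ-cancel-≤ (begin
  toℚᵘ (↑ i)   ≃⟨ toℚᵘ-↑ i ⟩
  mkℚᵘ i 0     ≤⟨ *≤* (ℤ.*-monoʳ-≤-nonNeg (+ 1) i≤j) ⟩
  mkℚᵘ j 0     ≃⟨ toℚᵘ-↑ j ⟨
  toℚᵘ (↑ j)   ∎)
  where open ℚᵘ.≤-Reasoning

Σ<-1 : ∀ n → Σ< n (λ _ → 1ℚ) ≡ ↑ (+ n)
Σ<-1 zero    = ≡.refl
Σ<-1 (suc n) = ≡.trans (cong (1ℚ ℚ.+_) (Σ<-1 n)) (≡.sym (↑-+ (+ 1) (+ n)))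

-- Binary digits and the Thue-Morse recurrences

digitSum : List (Fin 2) → ℕ
digitSum ds = sumℕ (map toℕ ds)

-- Two digit lists of one number differ only in high-order zeros. Since `toDigits` returns its
-- digits with a proof of their value, the recurrences of `s₂` follow without unfolding its
-- algorithm.
digitSum-unique : ∀ ds es → fromDigits ds ≡ fromDigits es → digitSum ds ≡ digitSum es
digitSum-unique []       []       _  = ≡.refl
digitSum-unique []       (zero ∷ es) eq =
  digitSum-unique [] es (ℕ.*-cancelʳ-≡ 0 (fromDigits es) 2 eq)
digitSum-unique []       (suc zero ∷ es) ()
digitSum-unique (zero ∷ ds) [] eq =
  digitSum-unique ds [] (ℕ.*-cancelʳ-≡ (fromDigits ds) 0 2 eq)
digitSum-unique (suc zero ∷ ds) [] ()
digitSum-unique (d ∷ ds) (e ∷ es) eq = cong₂ ℕ._+_ d≡e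
  (digitSum-unique ds es (ℕ.*-cancelʳ-≡ (fromDigits ds) (fromDigits es) 2
    (ℕ.+-cancelˡ-≡ (toℕ d) _ _ (≡.trans eq (cong (ℕ._+ fromDigits es ℕ.* 2) (≡.sym d≡e))))))
  where
  last-digit : ∀ (d : Fin 2) x → (toℕ d ℕ.+ x ℕ.* 2) % 2 ≡ toℕ d
  last-digit zero       x = [m+kn]%n≡m%n 0 x 2
  last-digit (suc zero) x = [m+kn]%n≡m%n 1 x 2
  d≡e : toℕ d ≡ toℕ e
  d≡e = ≡.trans (≡.sym (last-digit d (fromDigits ds))) (≡.trans (cong (_% 2) eq) (last-digit e (fromDigits es)))

s₂-snoc : ∀ (d : Fin 2) n → s₂ (toℕ d ℕ.+ 2 ℕ.* n) ≡ toℕ d ℕ.+ s₂ n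
s₂-snoc d n = digitSum-unique
  (proj₁ (toDigits 2 (toℕ d ℕ.+ 2 ℕ.* n))) (d ∷ proj₁ (toDigits 2 n))
  (≡.trans (proj₂ (toDigits 2 (toℕ d ℕ.+ 2 ℕ.* n)))
    (cong (toℕ d ℕ.+_) (≡.trans (ℕ.*-comm 2 n) (cong (ℕ._* 2) (≡.sym (proj₂ (toDigits 2 n)))))))

η-even : ∀ n → η (2 ℕ.* n) ≡ η n
η-even n = cong (-1ℤ ℤ.^_) (s₂-snoc zero n)

η-odd : ∀ n → η (suc (2 ℕ.* n)) ≡ ℤ.- η n
η-odd n = ≡.trans (cong (-1ℤ ℤ.^_) (s₂-snoc (suc zero) n)) (ℤ.-1*i≡-i (η n))

-- Σ_{n < 2ˢ} η(n) xⁿ = ∏_{m < s} (1 − x^(2ᵐ)), with x = T^(c 0).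
thueMorse-Δs : ∀ s (c : ℕ → ℕ) → (∀ m → c (suc m) ≡ 2 ℕ.* c m) → ∀ f i →
  Σ< (2 ℕ.^ s) (λ n → ↑ (η n) * f (n ℕ.* c 0 ℕ.+ i)) ≡ Δs (applyUpTo c s) f i
thueMorse-Δs zero    c double f i =
  solve 1 (λ x → con (↑ (η 0)) :* x :+ con 0ℚ := x) ≡.refl (f i)
  where open +-*-Solver
thueMorse-Δs (suc s) c double f i = begin
  Σ< (2 ℕ.^ suc s) u
    ≡⟨ Σ<-pairs (2 ℕ.^ s) u ⟩
  Σ< (2 ℕ.^ s) (λ n → u (2 ℕ.* n) + u (suc (2 ℕ.* n)))
    ≡⟨ Σ<-cong (2 ℕ.^ s) pair ⟩
  Σ< (2 ℕ.^ s) (λ n → v i n - v (c 0 ℕ.+ i) n)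
    ≡⟨ sum-distrib-minus {2 ℕ.^ s} (λ n → v i (toℕ n)) (λ n → v (c 0 ℕ.+ i) (toℕ n)) ⟩
  Σ< (2 ℕ.^ s) (v i) - Σ< (2 ℕ.^ s) (v (c 0 ℕ.+ i))
    ≡⟨ cong₂ _-_ (thueMorse-Δs s (c ∘ suc) (double ∘ suc) f i)
                 (thueMorse-Δs s (c ∘ suc) (double ∘ suc) f (c 0 ℕ.+ i)) ⟩
  Δs (applyUpTo c (suc s)) f i ∎
  where
  open ≡-Reasoning
  u : ℕ → ℚ
  u n = ↑ (η n) * f (n ℕ.* c 0 ℕ.+ i)
  v : ℕ → ℕ → ℚ
  v i n = ↑ (η n) * f (n ℕ.* c 1 ℕ.+ i)
  even-index : ∀ n c i → 2 ℕ.* n ℕ.* c ℕ.+ i ≡ n ℕ.* (2 ℕ.* c) ℕ.+ i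
  even-index = ℕSolver.solve-∀
  odd-index : ∀ n c i → suc (2 ℕ.* n) ℕ.* c ℕ.+ i ≡ n ℕ.* (2 ℕ.* c) ℕ.+ (c ℕ.+ i)
  odd-index = ℕSolver.solve-∀
  pair : ∀ n → u (2 ℕ.* n) + u (suc (2 ℕ.* n)) ≡ v i n - v (c 0 ℕ.+ i) n
  pair n = cong₂ _+_
    (cong₂ (λ a j → ↑ a * f j) (η-even n)
      (≡.trans (even-index n (c 0) i) (cong (λ d → n ℕ.* d ℕ.+ i) (≡.sym (double 0)))))
    (begin
      ↑ (η (suc (2 ℕ.* n))) * f (suc (2 ℕ.* n) ℕ.* c 0 ℕ.+ i)
        ≡⟨ cong₂ (λ a j → ↑ a * f j) (η-odd n)
             (≡.trans (odd-index n (c 0) i) (cong (λ d → n ℕ.* d ℕ.+ (c 0 ℕ.+ i)) (≡.sym (double 0)))) ⟩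
      ↑ (ℤ.- η n) * f (n ℕ.* c 1 ℕ.+ (c 0 ℕ.+ i))
        ≡⟨ cong (_* f (n ℕ.* c 1 ℕ.+ (c 0 ℕ.+ i))) (↑-neg (η n)) ⟩
      (ℚ.- ↑ (η n)) * f (n ℕ.* c 1 ℕ.+ (c 0 ℕ.+ i))
        ≡⟨ ℚ.neg-distribˡ-* (↑ (η n)) _ ⟨
      ℚ.- v (c 0 ℕ.+ i) n ∎)

-- Matrix rows as finite differences

[_] : ∀ {A : Set} → Dec A → ℚ
[ d ] = if does d then 1ℚ else 0ℚ

[]-yes : ∀ {A : Set} (d : Dec A) → A → [ d ] ≡ 1ℚ
[]-yes (yes _) _ = ≡.refl
[]-yes (no ¬a) a = contradiction a ¬a

[]-no : ∀ {A : Set} (d : Dec A) → ¬ A → [ d ] ≡ 0ℚ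
[]-no (yes a) ¬a = contradiction a ¬a
[]-no (no _)  _  = ≡.refl

[]-cong : ∀ {A B : Set} (d : Dec A) (e : Dec B) → (A → B) → (B → A) → [ d ] ≡ [ e ]
[]-cong (yes a) e f g = ≡.sym ([]-yes e (f a))
[]-cong (no ¬a) e f g = ≡.sym ([]-no e (¬a ∘ g))

-- The generator `f` is a parameter for the sake of the induction: the tail of `applyUpTo f` is
-- generated by `f ∘ suc`.
↑-foldr-filter : ∀ {P : ℕ → Set} (P? : ∀ n → Dec (P n)) (w : ℕ → ℤ) (f : ℕ → ℕ) N →
  ↑ (foldr ℤ._+_ 0ℤ (map w (filter P? (applyUpTo f N)))) ≡ Σ< N (λ n → [ P? (f n) ] * ↑ (w (f n)))
↑-foldr-filter P? w f zero    = ≡.refl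
↑-foldr-filter P? w f (suc N) with P? (f 0)
... | yes _ = ≡.trans (↑-+ (w (f 0)) _)
  (cong₂ _+_ (≡.sym (ℚ.*-identityˡ (↑ (w (f 0))))) (↑-foldr-filter P? w (f ∘ suc) N))
... | no _  = ≡.trans (↑-foldr-filter P? w (f ∘ suc) N)
  (≡.trans (≡.sym (ℚ.+-identityˡ rest)) (cong (λ z → z + rest) (≡.sym (ℚ.*-zeroˡ (↑ (w (f 0)))))))
  where rest = Σ< N (λ n → [ P? (f (suc n)) ] * ↑ (w (f (suc n))))

sum-zero : ∀ {n} (f : Fin n → ℚ) → (∀ i → f i ≡ 0ℚ) → sum f ≡ 0ℚ
sum-zero {n} f f≗0 = ≡.trans (sum-cong-≗ {n} f≗0) (Σ<-zero n)

sum-single : ∀ {n} (f : Fin n → ℚ) k → (∀ l → l ≢ k → f l ≡ 0ℚ) → sum f ≡ f k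
sum-single f zero    f≗0 = ≡.trans
  (cong (f zero ℚ.+_) (sum-zero (f ∘ suc) (λ l → f≗0 (suc l) λ ()))) (ℚ.+-identityʳ (f zero))
sum-single f (suc k) f≗0 = ≡.trans
  (cong₂ _+_ (f≗0 zero λ ()) (sum-single (f ∘ suc) k (λ l l≢k → f≗0 (suc l) (l≢k ∘ Fin.suc-injective))))
  (ℚ.+-identityˡ (f (suc k)))

-- The p-periodic function m ↦ x(−m).
reflected : ∀ p → (Fin p → ℚ) → ℕ → ℚ
reflected p x m = sum {p} (λ k → [ + p ∣? + m ℤ.+ + toℕ k ] * x k)

reflected-periodic : ∀ p x → Periodic p (reflected p x)
reflected-periodic p x m = sum-cong-≗ {p} λ k → cong (_* x k)
  ([]-cong (+ p ∣? + (p ℕ.+ m) ℤ.+ + toℕ k) (+ p ∣? + m ℤ.+ + toℕ k)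
    (λ p∣ → subst (+ p ∣_) (drop-p k) (∣m∣n⇒∣m-n p∣ ∣-refl))
    (λ p∣ → subst (+ p ∣_) (add-p k) (∣m∣n⇒∣m+n p∣ ∣-refl)))
  where
  drop-ring : ∀ p m k → (p ℤ.+ m ℤ.+ k) ℤ.- p ≡ m ℤ.+ k
  drop-ring = ℤSolver.solve-∀
  drop-p : ∀ k → (+ (p ℕ.+ m) ℤ.+ + toℕ {p} k) ℤ.- + p ≡ + m ℤ.+ + toℕ k
  drop-p k = drop-ring (+ p) (+ m) (+ toℕ k)
  add-ring : ∀ p m k → (m ℤ.+ k) ℤ.+ p ≡ p ℤ.+ m ℤ.+ k
  add-ring = ℤSolver.solve-∀
  add-p : ∀ k → (+ m ℤ.+ + toℕ {p} k) ℤ.+ + p ≡ + (p ℕ.+ m) ℤ.+ + toℕ k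
  add-p k = add-ring (+ p) (+ m) (+ toℕ k)

pos-∸ : ∀ {m n} → n ℕ.≤ m → + (m ℕ.∸ n) ≡ + m ℤ.- + n
pos-∸ {m} {n} n≤m = ≡.trans (≡.sym (ℤ.⊖-≥ n≤m)) (≡.sym (ℤ.m-n≡m⊖n m n))

-- The sum (p - k) + l lies strictly between 0 and 2p, so the only multiple of p it can be is p
-- itself.
residue-unique : ∀ {p k l} → k ℕ.< p → l ℕ.< p → p ℕ.∣ (p ℕ.∸ k) ℕ.+ l → l ≡ k
residue-unique {p} {k} {l} k<p l<p (ℕ.divides zero eq) =
  contradiction (ℕ.m+n≡0⇒m≡0 (p ℕ.∸ k) eq) (ℕ.m>n⇒m∸n≢0 k<p)
residue-unique {p} {k} {l} k<p l<p (ℕ.divides (suc zero) eq) =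
  ℕ.+-cancelˡ-≡ (p ℕ.∸ k) l k (≡.trans eq (≡.trans (ℕ.+-identityʳ p) (≡.sym (ℕ.m∸n+n≡m (ℕ.<⇒≤ k<p)))))
residue-unique {p} {k} {l} k<p l<p (ℕ.divides (suc (suc q)) eq) =
  contradiction (ℕ.+-mono-≤-< (ℕ.m∸n≤m p k) l<p) (ℕ.≤⇒≯ (ℕ.≤-trans
    (ℕ.+-monoʳ-≤ p (ℕ.m≤m+n p (q ℕ.* p))) (ℕ.≤-reflexive (≡.sym eq))))

reflected-∸ : ∀ p x k → reflected p x (p ℕ.∸ toℕ k) ≡ x k
reflected-∸ p x k = ≡.trans
  (sum-single {p} _ k λ l l≢k → ≡.trans (cong (_* x l) ([]-no (+ p ∣? _) (l≢k ∘ same l))) (ℚ.*-zeroˡ (x l)))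
  (≡.trans (cong (_* x k) ([]-yes (+ p ∣? _) hit)) (ℚ.*-identityˡ (x k)))
  where
  index : ∀ l → + (p ℕ.∸ toℕ k) ℤ.+ + toℕ {p} l ≡ + p ℤ.+ (+ toℕ l ℤ.- + toℕ k)
  index l = ≡.trans (cong (λ z → z ℤ.+ + toℕ l) (pos-∸ (Fin.toℕ≤n k))) (ring (+ p) (+ toℕ k) (+ toℕ l))
    where
    ring : ∀ p k l → (p ℤ.- k) ℤ.+ l ≡ p ℤ.+ (l ℤ.- k)
    ring = ℤSolver.solve-∀
  hit : + p ∣ + (p ℕ.∸ toℕ k) ℤ.+ + toℕ k
  hit = subst (+ p ∣_) (≡.sym (≡.trans (index k)
    (≡.trans (cong (λ z → + p ℤ.+ z) (ℤ.+-inverseʳ (+ toℕ k))) (ℤ.+-identityʳ (+ p))))) ∣-refl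
  same : ∀ l → + p ∣ + (p ℕ.∸ toℕ k) ℤ.+ + toℕ l → l ≡ k
  same l p∣ = Fin.toℕ-injective (residue-unique (Fin.toℕ<n k) (Fin.toℕ<n l) (∣⇒∣ᵤ p∣))

rowSum : ∀ p s → (Fin p → ℚ) → Fin p → ℚ
rowSum p s x i = sum {p} (λ k → ↑ (S p (+ toℕ i ℤ.- + toℕ k) (2 ℕ.^ s)) * x k)

-- Row i is the convolution of η with x, the sum of η(n) x(i - n). For g(m) = x(-m) the second
-- factor is g(n - i), so a polynomial in the forward shift acts on g, and the result is read at -i,
-- represented by p - i.
rowSum-Δs : ∀ p s x i →
  rowSum p s x i ≡ Δs (applyUpTo (2 ℕ.^_) s) (reflected p x) (p ℕ.∸ toℕ i)
rowSum-Δs p s x i = begin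
  sum {p} (λ k → ↑ (S p (+ toℕ i ℤ.- + toℕ k) N) * x k)
    ≡⟨ sum-cong-≗ {p} (λ k → cong (_* x k) (↑-foldr-filter (λ n → + p ∣? + n ℤ.- (+ toℕ i ℤ.- + toℕ k)) η id N)) ⟩
  sum {p} (λ k → Σ< N (λ n → a n k * ↑ (η n)) * x k)
    ≡⟨ sum-cong-≗ {p} (λ k → *-distribʳ-sum {N} (x k) (λ n → a (toℕ n) k * ↑ (η (toℕ n)))) ⟩
  sum {p} (λ k → Σ< N (λ n → a n k * ↑ (η n) * x k))
    ≡⟨ ∑-comm {p} {N} (λ k n → a (toℕ n) k * ↑ (η (toℕ n)) * x k) ⟩
  Σ< N (λ n → sum {p} (λ k → a n k * ↑ (η n) * x k))
    ≡⟨ Σ<-cong N (λ n → sum-cong-≗ {p} (term n)) ⟩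
  Σ< N (λ n → sum {p} (λ k → ↑ (η n) * (b n k * x k)))
    ≡⟨ Σ<-cong N (λ n → *-distribˡ-sum {p} (↑ (η n)) (λ k → b n k * x k)) ⟨
  Σ< N (λ n → ↑ (η n) * reflected p x (n ℕ.* 1 ℕ.+ (p ℕ.∸ toℕ i)))
    ≡⟨ thueMorse-Δs s (2 ℕ.^_) (λ _ → ≡.refl) (reflected p x) (p ℕ.∸ toℕ i) ⟩
  Δs (applyUpTo (2 ℕ.^_) s) (reflected p x) (p ℕ.∸ toℕ i) ∎
  where
  open ≡-Reasoning
  open +-*-Solver
  N = 2 ℕ.^ s
  a b : ℕ → Fin p → ℚ
  a n k = [ + p ∣? + n ℤ.- (+ toℕ i ℤ.- + toℕ k) ]
  b n k = [ + p ∣? + (n ℕ.* 1 ℕ.+ (p ℕ.∸ toℕ i)) ℤ.+ + toℕ k ]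
  shift-by-p : ∀ n k → + (n ℕ.* 1 ℕ.+ (p ℕ.∸ toℕ i)) ℤ.+ + toℕ {p} k ≡ (+ n ℤ.- (+ toℕ i ℤ.- + toℕ k)) ℤ.+ + p
  shift-by-p n k = begin
    + (n ℕ.* 1 ℕ.+ (p ℕ.∸ toℕ i)) ℤ.+ + toℕ k
      ≡⟨ cong (λ m → + (m ℕ.+ (p ℕ.∸ toℕ i)) ℤ.+ + toℕ k) (ℕ.*-identityʳ n) ⟩
    (+ n ℤ.+ + (p ℕ.∸ toℕ i)) ℤ.+ + toℕ k
      ≡⟨ cong (λ z → (+ n ℤ.+ z) ℤ.+ + toℕ k) (pos-∸ (Fin.toℕ≤n i)) ⟩
    (+ n ℤ.+ (+ p ℤ.- + toℕ i)) ℤ.+ + toℕ k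
      ≡⟨ ring (+ n) (+ p) (+ toℕ i) (+ toℕ k) ⟩
    (+ n ℤ.- (+ toℕ i ℤ.- + toℕ k)) ℤ.+ + p ∎
    where
    ring : ∀ n p i k → (n ℤ.+ (p ℤ.- i)) ℤ.+ k ≡ (n ℤ.- (i ℤ.- k)) ℤ.+ p
    ring = ℤSolver.solve-∀
  add-sub : ∀ z q → (z ℤ.+ q) ℤ.- q ≡ z
  add-sub = ℤSolver.solve-∀
  a≡b : ∀ n k → a n k ≡ b n k
  a≡b n k = []-cong (+ p ∣? z) (+ p ∣? _)
    (λ p∣ → subst (+ p ∣_) (≡.sym (shift-by-p n k)) (∣m∣n⇒∣m+n p∣ ∣-refl))
    (λ p∣ → subst (+ p ∣_) (≡.trans (cong (λ z → z ℤ.- + p) (shift-by-p n k)) (add-sub z (+ p)))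
      (∣m∣n⇒∣m-n p∣ ∣-refl))
    where z = + n ℤ.- (+ toℕ i ℤ.- + toℕ k)
  term : ∀ n k → a n k * ↑ (η n) * x k ≡ ↑ (η n) * (b n k * x k)
  term n k = ≡.trans (cong (λ c → c * ↑ (η n) * x k) (a≡b n k))
    (solve 3 (λ b e x → b :* e :* x := e :* (b :* x)) ≡.refl (b n k) (↑ (η n)) (x k))

-- The points p - i run through a full period, so both norms can be computed on the reflected
-- sequences. There `Δs-bound` applies, once the shifts are reduced modulo p.
rowSum-bound : ∀ {p t} → Prime p → p ≢ 2 → let s = suc (2 ℕ.* t) in
  p ≡ suc (s ℕ.+ s) → IsOrderOf2 p s → ∀ x →
  sum (λ i → rowSum p s x i * rowSum p s x i) ≤ ↑ (+ p) * sum (λ k → x k * x k)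
rowSum-bound {p} {t} pr p≢2 ≡.refl ord x = begin
  sum (λ i → rowSum p s x i * rowSum p s x i)
    ≡⟨ sum-cong-≗ {p} (λ i → cong₂ _*_ (rowSum-Δs p s x i) (rowSum-Δs p s x i)) ⟩
  sum {p} (λ i → D (p ℕ.∸ toℕ i) * D (p ℕ.∸ toℕ i))
    ≡⟨ Σ<-reflect p (λ i → cong₂ _*_ (D-periodic i) (D-periodic i)) ⟩
  ⟨ D , D ⟩[ p ]
    ≡⟨ Σ<-cong p (λ i → cong₂ _*_ (reduce i) (reduce i)) ⟩
  ⟨ Δs L g , Δs L g ⟩[ p ]
    ≤⟨ Δs-bound _ {L = L} g-periodic pr (All.applyUpTo⁺₂ _ s (λ m → m%n≤n (2 ℕ.^ m) p))
         (±2^-residues-↭ {t = t} pr p≢2 ≡.refl ord) ⟩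
  Σ< p (λ _ → 1ℚ) * ⟨ g , g ⟩[ p ]
    ≡⟨ cong₂ _*_ (Σ<-1 p) norm ⟩
  ↑ (+ p) * sum (λ k → x k * x k) ∎
  where
  open ℚ.≤-Reasoning
  s = suc (2 ℕ.* t)
  g = reflected p x
  g-periodic : Periodic p g
  g-periodic = reflected-periodic p x
  D = Δs (applyUpTo (2 ℕ.^_) s) g
  D-periodic : Periodic p D
  D-periodic = Δs-periodic (applyUpTo (2 ℕ.^_) s) g-periodic
  L = applyUpTo (λ m → 2 ℕ.^ m % p) s
  reduce : ∀ i → D i ≡ Δs L g i
  reduce i = ≡.trans (≡.sym (Δs-% g-periodic (applyUpTo (2 ℕ.^_) s) i))
    (cong (λ K → Δs K g i) (List.map-applyUpTo (2 ℕ.^_) (_% p) s))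
  norm : ⟨ g , g ⟩[ p ] ≡ sum (λ k → x k * x k)
  norm = ≡.trans (≡.sym (Σ<-reflect p (λ i → cong₂ _*_ (g-periodic i) (g-periodic i))))
    (sum-cong-≗ {p} (λ k → cong₂ _*_ (reflected-∸ p x k) (reflected-∸ p x k)))

-- The bound on the eigenvalues

≤⇒≯ : ∀ {p q} → p ≤ q → ¬ q < p
≤⇒≯ p≤q q<p = ℚ.<-irrefl ≡.refl (ℚ.≤-<-trans p≤q q<p)

p≤q⇒0≤q-p : ∀ {p q} → p ≤ q → 0ℚ ≤ q - p
p≤q⇒0≤q-p {p} {q} p≤q = subst (_≤ q - p) (ℚ.+-inverseʳ p) (ℚ.+-monoˡ-≤ (ℚ.- p) p≤q)

+-slack-≤ : ∀ {p q r} → 0ℚ ≤ r → q ≡ p + r → p ≤ q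
+-slack-≤ {p} {r = r} 0≤r ≡.refl = subst (_≤ p + r) (ℚ.+-identityʳ p) (ℚ.+-monoʳ-≤ p 0≤r)

+-slack-< : ∀ {p q r} → 0ℚ < r → q ≡ p + r → p < q
+-slack-< {p} {r = r} 0<r ≡.refl = subst (_< p + r) (ℚ.+-identityʳ p) (ℚ.+-monoʳ-< p 0<r)

*-nonNeg : ∀ {p q} → 0ℚ ≤ p → 0ℚ ≤ q → 0ℚ ≤ p * q
*-nonNeg {p} {q} 0≤p 0≤q = ℚ.nonNegative⁻¹ (p * q)
  {{ℚ.nonNeg*nonNeg⇒nonNeg p {{ℚ.nonNegative 0≤p}} q {{ℚ.nonNegative 0≤q}}}}

*-pos : ∀ {p q} → 0ℚ < p → 0ℚ < q → 0ℚ < p * q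
*-pos {p} {q} 0<p 0<q = ℚ.positive⁻¹ (p * q)
  {{ℚ.pos*pos⇒pos p {{ℚ.positive 0<p}} q {{ℚ.positive 0<q}}}}

p≤∣p∣ : ∀ p → p ≤ ∣ p ∣
p≤∣p∣ p with ℚ.≤-total 0ℚ p
... | inj₁ 0≤p = ℚ.≤-reflexive (≡.sym (ℚ.0≤p⇒∣p∣≡p 0≤p))
... | inj₂ p≤0 = ℚ.≤-trans p≤0 (ℚ.0≤∣p∣ p)

-p≤∣p∣ : ∀ p → ℚ.- p ≤ ∣ p ∣
-p≤∣p∣ p = subst (ℚ.- p ≤_) (ℚ.∣-p∣≡∣p∣ p) (p≤∣p∣ (ℚ.- p))

∣p∣²≡p² : ∀ p → ∣ p ∣ * ∣ p ∣ ≡ p * p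
∣p∣²≡p² p = ≡.trans (≡.sym (ℚ.∣p*q∣≡∣p∣*∣q∣ p p)) (ℚ.0≤p⇒∣p∣≡p (0≤x² p))

p²<q²⇒∣p∣<q : ∀ {p q} → 0ℚ < q → p * p < q * q → ∣ p ∣ < q
p²<q²⇒∣p∣<q {p} {q} 0<q p²<q² with ∣ p ∣ ℚ.<? q
... | yes ∣p∣<q = ∣p∣<q
... | no  ∣p∣≮q = contradiction p²<q² (≤⇒≯ (begin
  q * q           ≤⟨ ℚ.*-monoˡ-≤-nonNeg q {{ℚ.pos⇒nonNeg q {{ℚ.positive 0<q}}}} q≤∣p∣ ⟩
  q * ∣ p ∣       ≤⟨ ℚ.*-monoʳ-≤-nonNeg ∣ p ∣ {{ℚ.∣-∣-nonNeg p}} q≤∣p∣ ⟩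
  ∣ p ∣ * ∣ p ∣   ≡⟨ ∣p∣²≡p² p ⟩
  p * p           ∎))
  where
  open ℚ.≤-Reasoning
  q≤∣p∣ : q ≤ ∣ p ∣
  q≤∣p∣ = ℚ.≮⇒≥ ∣p∣≮q

-- Null and bounded rational sequences

Eventually : (ℕ → Set) → Set
Eventually P = ∃[ N ] ∀ n → N ℕ.≤ n → P n

eventually-map : ∀ {P Q : ℕ → Set} → (∀ n → P n → Q n) → Eventually P → Eventually Q
eventually-map f (N , p) = N , λ n n≥ → f n (p n n≥)

eventually-× : ∀ {P Q : ℕ → Set} → Eventually P → Eventually Q → Eventually (λ n → P n × Q n)
eventually-× (N , p) (K , q) = N ⊔ K , λ n n≥ →
  p n (ℕ.m⊔n≤o⇒m≤o N K n≥) , q n (ℕ.m⊔n≤o⇒n≤o N K n≥)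

eventually-witness : ∀ {P : ℕ → Set} → Eventually P → ∃[ n ] P n
eventually-witness (N , p) = N , p N ℕ.≤-refl

Null : (ℕ → ℚ) → Set
Null x = ∀ ε → 0ℚ < ε → Eventually (λ n → ∣ x n ∣ < ε)

Bounded : (ℕ → ℚ) → Set
Bounded x = ∃[ B ] 0ℚ < B × Eventually (λ n → ∣ x n ∣ ≤ B)

cauchy⇒bounded : ∀ (x : ℝ) → Bounded (seq x)
cauchy⇒bounded x with cauchy x 1ℚ (ℚ.positive⁻¹ 1ℚ)
... | N , p = 1ℚ + ∣ seq x N ∣ ,
  ℚ.+-mono-<-≤ (ℚ.positive⁻¹ 1ℚ) (ℚ.0≤∣p∣ (seq x N)) , N , λ n n≥ → begin
    ∣ seq x n ∣
      ≡⟨ cong ∣_∣ (solve 2 (λ a b → a := (a :- b) :+ b) ≡.refl (seq x n) (seq x N)) ⟩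
    ∣ (seq x n - seq x N) + seq x N ∣
      ≤⟨ ℚ.∣p+q∣≤∣p∣+∣q∣ (seq x n - seq x N) (seq x N) ⟩
    ∣ seq x n - seq x N ∣ + ∣ seq x N ∣
      ≤⟨ ℚ.+-monoˡ-≤ ∣ seq x N ∣ (ℚ.<⇒≤ (p n N n≥ ℕ.≤-refl)) ⟩
    1ℚ + ∣ seq x N ∣ ∎
  where
  open ℚ.≤-Reasoning
  open +-*-Solver

Null-cong : ∀ {x y} → (∀ n → x n ≡ y n) → Null x → Null y
Null-cong x≗y nx ε 0<ε = eventually-map (λ n → subst (λ z → ∣ z ∣ < ε) (x≗y n)) (nx ε 0<ε)

Null-+ : ∀ {x y} → Null x → Null y → Null (λ n → x n + y n)
Null-+ {x} {y} nx ny ε 0<ε = eventually-map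
  (λ n (x< , y<) → ℚ.≤-<-trans (ℚ.∣p+q∣≤∣p∣+∣q∣ (x n) (y n))
    (subst (∣ x n ∣ + ∣ y n ∣ <_) halves (ℚ.+-mono-< x< y<)))
  (eventually-× (nx (ε * ½) 0<ε/2) (ny (ε * ½) 0<ε/2))
  where
  open +-*-Solver
  0<ε/2 : 0ℚ < ε * ½
  0<ε/2 = *-pos 0<ε (ℚ.positive⁻¹ ½)
  halves : ε * ½ + ε * ½ ≡ ε
  halves = solve 1 (λ e → e :* con ½ :+ e :* con ½ := e) ≡.refl ε

Null-* : ∀ {x y} → Null x → Bounded y → Null (λ n → x n * y n)
Null-* {x} {y} nx (B , 0<B , y≤B) ε 0<ε = eventually-map
  (λ n (x< , y≤) → begin-strict
    ∣ x n * y n ∣      ≡⟨ ℚ.∣p*q∣≡∣p∣*∣q∣ (x n) (y n) ⟩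
    ∣ x n ∣ * ∣ y n ∣  ≤⟨ ℚ.*-monoˡ-≤-nonNeg ∣ x n ∣ {{ℚ.∣-∣-nonNeg (x n)}} y≤ ⟩
    ∣ x n ∣ * B        <⟨ ℚ.*-monoˡ-<-pos B x< ⟩
    (ε * 1/B) * B      ≡⟨ ℚ.*-assoc ε 1/B B ⟩
    ε * (1/B * B)      ≡⟨ cong (ε *_) (ℚ.*-inverseˡ B) ⟩
    ε * 1ℚ             ≡⟨ ℚ.*-identityʳ ε ⟩
    ε                  ∎)
  (eventually-× (nx (ε * 1/B) (*-pos 0<ε (ℚ.positive⁻¹ 1/B {{ℚ.1/pos⇒pos B}}))) y≤B)
  where
  open ℚ.≤-Reasoning
  instance
    B-pos : ℚ.Positive B
    B-pos = ℚ.positive 0<B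
    B-nonZero : ℚ.NonZero B
    B-nonZero = ℚ.pos⇒nonZero B
  1/B = ℚ.1/ B

Null-sum : ∀ {m} (x : Fin m → ℕ → ℚ) → (∀ i → Null (x i)) → Null (λ n → sum (λ i → x i n))
Null-sum {zero}  x nx ε 0<ε = 0 , λ _ _ → 0<ε
Null-sum {suc m} x nx = Null-+ (nx zero) (Null-sum (x ∘ suc) (nx ∘ suc))

Null-squares : ∀ x y → x ≃ y → Null (λ n → seq x n * seq x n - seq y n * seq y n)
Null-squares x y x≃y = Null-cong
  (λ n → solve 2 (λ a b → (a :- b) :* (a :+ b) := a :* a :- b :* b) ≡.refl (seq x n) (seq y n))
  (Null-* x≃y (cauchy⇒bounded (x +ℝ y)))
  where open +-*-Solver

sum-nonNeg : ∀ {m} (f : Fin m → ℚ) → (∀ i → 0ℚ ≤ f i) → 0ℚ ≤ sum f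
sum-nonNeg {zero}  f 0≤f = ℚ.≤-refl
sum-nonNeg {suc m} f 0≤f = ℚ.+-mono-≤ (0≤f zero) (sum-nonNeg (f ∘ suc) (0≤f ∘ suc))

term≤sum : ∀ {m} (f : Fin m → ℚ) → (∀ i → 0ℚ ≤ f i) → ∀ k → f k ≤ sum f
term≤sum f 0≤f zero    = +-slack-≤ (sum-nonNeg (f ∘ suc) (0≤f ∘ suc)) ≡.refl
term≤sum f 0≤f (suc k) = ℚ.≤-trans (term≤sum (f ∘ suc) (0≤f ∘ suc) k)
  (+-slack-≤ (0≤f zero) (ℚ.+-comm (f zero) _))

seq-re-sumᶜ : ∀ {m} (f : Fin m → ℂ) n → seq (re (sumᶜ f)) n ≡ sum (λ i → seq (re (f i)) n)
seq-re-sumᶜ {zero}  f n = ≡.refl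
seq-re-sumᶜ {suc m} f n = cong (λ z → seq (re (f zero)) n + z) (seq-re-sumᶜ (f ∘ suc) n)

seq-im-sumᶜ : ∀ {m} (f : Fin m → ℂ) n → seq (im (sumᶜ f)) n ≡ sum (λ i → seq (im (f i)) n)
seq-im-sumᶜ {zero}  f n = ≡.refl
seq-im-sumᶜ {suc m} f n = cong (λ z → seq (im (f zero)) n + z) (seq-im-sumᶜ (f ∘ suc) n)

-- From the norm bound to the modulus of an eigenvalue

module _ {p s : ℕ} (c : ℚ)
  (bound : ∀ x → sum (λ i → rowSum p s x i * rowSum p s x i) ≤ c * sum (λ k → x k * x k))
  (μ : ℂ) (r : ℝ) (v : Fin p → ℂ) (nonzero : ¬ (∀ i → v i ≃ᶜ 0ᶜ))
  (Mv≃μv : ∀ i → sumᶜ (λ j → M p s i j *ᶜ v j) ≃ᶜ μ *ᶜ v i)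
  (modulus : r *ℝ r ≃ re μ *ℝ re μ +ℝ im μ *ℝ im μ) where

  private
    open +-*-Solver

    X Y : ℕ → Fin p → ℚ
    X n k = seq (re (v k)) n
    Y n k = seq (im (v k)) n

    Mv : Fin p → ℂ
    Mv i = sumᶜ (λ j → M p s i j *ᶜ v j)

    re-Mv : ∀ n i → seq (re (Mv i)) n ≡ rowSum p s (X n) i
    re-Mv n i = ≡.trans (seq-re-sumᶜ (λ j → M p s i j *ᶜ v j) n)
      (sum-cong-≗ {p} (λ j → solve 3 (λ m x y → m :* x :- con 0ℚ :* y := m :* x) ≡.refl
        (↑ (S p (+ toℕ i ℤ.- + toℕ j) (2 ℕ.^ s))) (X n j) (Y n j)))

    im-Mv : ∀ n i → seq (im (Mv i)) n ≡ rowSum p s (Y n) i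
    im-Mv n i = ≡.trans (seq-im-sumᶜ (λ j → M p s i j *ᶜ v j) n)
      (sum-cong-≗ {p} (λ j → solve 3 (λ m x y → m :* y :+ con 0ℚ :* x := m :* y) ≡.refl
        (↑ (S p (+ toℕ i ℤ.- + toℕ j) (2 ℕ.^ s))) (X n j) (Y n j)))

    ∣v∣² ∣Mv∣² : Fin p → ℕ → ℚ
    ∣v∣² k n = X n k * X n k + Y n k * Y n k
    ∣Mv∣² i n = seq (re (Mv i)) n * seq (re (Mv i)) n + seq (im (Mv i)) n * seq (im (Mv i)) n

    r² E D : ℕ → ℚ
    r² n = seq r n * seq r n
    E n = sum {p} (λ k → ∣v∣² k n)
    D n = sum {p} (λ k → r² n * ∣v∣² k n - ∣Mv∣² k n)

    -- Since |μ|² |vₖ|² = |μ vₖ|², the expression splits into three null errors: r² against |μ|²,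
    -- and the squares of the real and imaginary parts of μ vₖ against those of (Mv)ₖ.
    null-term : ∀ k → Null (λ n → r² n * ∣v∣² k n - ∣Mv∣² k n)
    null-term k = Null-cong identity (Null-+ (Null-+
      (Null-* modulus (cauchy⇒bounded (re (v k) *ℝ re (v k) +ℝ im (v k) *ℝ im (v k))))
      (Null-cong (λ n → negate (seq (re (Mv k)) n) (seq (re (μ *ᶜ v k)) n))
        (Null-* (Null-squares (re (Mv k)) (re (μ *ᶜ v k)) (proj₁ (Mv≃μv k))) (cauchy⇒bounded (fromℚ (ℚ.- 1ℚ))))))
      (Null-cong (λ n → negate (seq (im (Mv k)) n) (seq (im (μ *ᶜ v k)) n))
        (Null-* (Null-squares (im (Mv k)) (im (μ *ᶜ v k)) (proj₂ (Mv≃μv k))) (cauchy⇒bounded (fromℚ (ℚ.- 1ℚ))))))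
      where
      negate : ∀ a b → (a * a - b * b) * ℚ.- 1ℚ ≡ b * b - a * a
      negate = solve 2 (λ a b → (a :* a :- b :* b) :* con (ℚ.- 1ℚ) := b :* b :- a :* a) ≡.refl
      ring : ∀ ρ a b x y R I →
        ((ρ - (a * a + b * b)) * (x * x + y * y) + ((a * x - b * y) * (a * x - b * y) - R * R))
          + ((a * y + b * x) * (a * y + b * x) - I * I)
        ≡ ρ * (x * x + y * y) - (R * R + I * I)
      ring = solve 7 (λ ρ a b x y R I →
        ((ρ :- (a :* a :+ b :* b)) :* (x :* x :+ y :* y) :+ ((a :* x :- b :* y) :* (a :* x :- b :* y) :- R :* R))
          :+ ((a :* y :+ b :* x) :* (a :* y :+ b :* x) :- I :* I)
        := ρ :* (x :* x :+ y :* y) :- (R :* R :+ I :* I)) ≡.refl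
      identity : ∀ n → _ ≡ r² n * ∣v∣² k n - ∣Mv∣² k n
      identity n = ring (r² n) (seq (re μ) n) (seq (im μ) n) (X n k) (Y n k) (seq (re (Mv k)) n) (seq (im (Mv k)) n)

    null-D : Null D
    null-D = Null-sum (λ k n → r² n * ∣v∣² k n - ∣Mv∣² k n) null-term

    D-expand : ∀ n → D n ≡ r² n * E n - sum {p} (λ k → ∣Mv∣² k n)
    D-expand n = ≡.trans (sum-distrib-minus {p} (λ k → r² n * ∣v∣² k n) (λ k → ∣Mv∣² k n))
      (cong (λ z → z - sum {p} (λ k → ∣Mv∣² k n)) (≡.sym (*-distribˡ-sum {p} (r² n) (λ k → ∣v∣² k n))))

    -- The matrix is real, so it acts separately on the real and imaginary parts of each approximant
    -- of v.
    contraction : ∀ n → sum {p} (λ k → ∣Mv∣² k n) ≤ c * E n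
    contraction n = begin
      sum {p} (λ k → ∣Mv∣² k n)
        ≡⟨ sum-cong-≗ {p} (λ k → cong₂ (λ a b → a * a + b * b) (re-Mv n k) (im-Mv n k)) ⟩
      sum {p} (λ k → rowSum p s (X n) k * rowSum p s (X n) k + rowSum p s (Y n) k * rowSum p s (Y n) k)
        ≡⟨ ∑-distrib-+ {p} (λ k → rowSum p s (X n) k * rowSum p s (X n) k) (λ k → rowSum p s (Y n) k * rowSum p s (Y n) k) ⟩
      sum {p} (λ k → rowSum p s (X n) k * rowSum p s (X n) k) + sum {p} (λ k → rowSum p s (Y n) k * rowSum p s (Y n) k)
        ≤⟨ ℚ.+-mono-≤ (bound (X n)) (bound (Y n)) ⟩
      c * sum {p} (λ k → X n k * X n k) + c * sum {p} (λ k → Y n k * Y n k)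
        ≡⟨ ℚ.*-distribˡ-+ c _ _ ⟨
      c * (sum {p} (λ k → X n k * X n k) + sum {p} (λ k → Y n k * Y n k))
        ≡⟨ cong (c *_) (∑-distrib-+ {p} (λ k → X n k * X n k) (λ k → Y n k * Y n k)) ⟨
      c * E n ∎
      where open ℚ.≤-Reasoning

    -- With such a gap, δ |v|² ≤ r² |v|² - |Mv|², which tends to 0. Every coordinate of v would then
    -- vanish.
    gap-impossible : ∀ δ → 0ℚ < δ → ¬ Eventually (λ n → c + δ ≤ r² n)
    gap-impossible δ 0<δ gap = nonzero (λ k →
      (λ ε 0<ε → eventually-map (λ n small → subst (λ z → ∣ z ∣ < ε) (≡.sym (ℚ.+-identityʳ (X n k)))
        (p²<q²⇒∣p∣<q 0<ε (ℚ.≤-<-trans (+-slack-≤ (0≤x² (Y n k)) ≡.refl) (small k)))) (v-small ε 0<ε)) ,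
      (λ ε 0<ε → eventually-map (λ n small → subst (λ z → ∣ z ∣ < ε) (≡.sym (ℚ.+-identityʳ (Y n k)))
        (p²<q²⇒∣p∣<q 0<ε (ℚ.≤-<-trans (+-slack-≤ (0≤x² (X n k)) (ℚ.+-comm (X n k * X n k) (Y n k * Y n k))) (small k)))) (v-small ε 0<ε)))
      where
      0≤∣v∣² : ∀ n k → 0ℚ ≤ ∣v∣² k n
      0≤∣v∣² n k = ℚ.+-mono-≤ (0≤x² (X n k)) (0≤x² (Y n k))
      δE≤D : ∀ n → c + δ ≤ r² n → δ * E n ≤ D n
      δE≤D n c+δ≤r² = +-slack-≤
        (ℚ.+-mono-≤ (*-nonNeg (p≤q⇒0≤q-p c+δ≤r²) (sum-nonNeg {p} _ (0≤∣v∣² n))) (p≤q⇒0≤q-p (contraction n)))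
        (≡.trans (D-expand n) (solve 5 (λ ρ E Q c δ →
          ρ :* E :- Q := δ :* E :+ ((ρ :- (c :+ δ)) :* E :+ (c :* E :- Q))) ≡.refl
          (r² n) (E n) (sum {p} (λ k → ∣Mv∣² k n)) c δ))
      v-small : ∀ ε → 0ℚ < ε → Eventually (λ n → ∀ k → ∣v∣² k n < ε * ε)
      v-small ε 0<ε = eventually-map
        (λ n (c+δ≤r² , D<) k → ℚ.≤-<-trans (term≤sum {p} _ (0≤∣v∣² n) k)
          (ℚ.*-cancelˡ-<-nonNeg δ {{ℚ.pos⇒nonNeg δ {{ℚ.positive 0<δ}}}}
            (ℚ.≤-<-trans (ℚ.≤-trans (δE≤D n c+δ≤r²) (p≤∣p∣ (D n))) D<)))
        (eventually-× gap (null-D (δ * (ε * ε)) (*-pos 0<δ (*-pos 0<ε 0<ε))))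

  -- Refuting a gap does not by itself produce a threshold. A term of r² within δ/4 of all later
  -- ones decides: if it is at most c + δ/2, all later ones stay below c + δ; otherwise they stay
  -- above c + δ/4, which `gap-impossible` excludes.
  modulus²≤ : ∀ δ → 0ℚ < δ → Eventually (λ n → seq r n * seq r n ≤ c + δ)
  modulus²≤ δ 0<δ with cauchy (r *ℝ r) (δ * ½ * ½) 0<δ/4
    where
    0<δ/4 : 0ℚ < δ * ½ * ½
    0<δ/4 = *-pos (*-pos 0<δ (ℚ.positive⁻¹ ½)) (ℚ.positive⁻¹ ½)
  ... | N , close with r² N ℚ.≤? c + δ * ½
  ...   | yes r²N≤ = N , λ n n≥ → +-slack-≤
          (ℚ.+-mono-≤ (ℚ.+-mono-≤ (p≤q⇒0≤q-p r²N≤)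
            (p≤q⇒0≤q-p (ℚ.≤-trans (p≤∣p∣ (r² n - r² N)) (ℚ.<⇒≤ (close n N n≥ ℕ.≤-refl)))))
            (ℚ.<⇒≤ (*-pos (*-pos 0<δ (ℚ.positive⁻¹ ½)) (ℚ.positive⁻¹ ½))))
          (solve 4 (λ c d a b → c :+ d := a :+
            (((c :+ d :* con ½ :- b) :+ (d :* con ½ :* con ½ :- (a :- b))) :+ d :* con ½ :* con ½))
            ≡.refl c δ (r² n) (r² N))
  ...   | no  r²N≰ = contradiction
          (N , λ n n≥ → +-slack-≤
            (ℚ.+-mono-≤ (p≤q⇒0≤q-p (ℚ.<⇒≤ (ℚ.≰⇒> r²N≰)))
              (p≤q⇒0≤q-p (ℚ.≤-trans (-p≤∣p∣ (r² n - r² N)) (ℚ.<⇒≤ (close n N n≥ ℕ.≤-refl)))))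
            (solve 4 (λ c d a b → a := (c :+ d :* con ½ :* con ½) :+
              ((b :- (c :+ d :* con ½)) :+ (d :* con ½ :* con ½ :- (:- (a :- b)))))
              ≡.refl c δ (r² n) (r² N)))
          (gap-impossible (δ * ½ * ½) (*-pos (*-pos 0<δ (ℚ.positive⁻¹ ½)) (ℚ.positive⁻¹ ½)))

-- Exponentials and logarithms

1/suc : ℕ → ℚ
1/suc n = + 1 ℚ./ suc n

1/suc-inverse : ∀ n → 1/suc n * ↑ (+ suc n) ≡ 1ℚ
1/suc-inverse n = ℚ.toℚᵘ-injective (begin
  toℚᵘ (1/suc n * ↑ (+ suc n))              ≈⟨ ℚ.toℚᵘ-homo-* (1/suc n) (↑ (+ suc n)) ⟩
  toℚᵘ (1/suc n) ℚᵘ.* toℚᵘ (↑ (+ suc n))    ≈⟨ ℚᵘ.*-cong (ℚ.toℚᵘ-fromℚᵘ (mkℚᵘ (+ 1) n)) (toℚᵘ-↑ (+ suc n)) ⟩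
  mkℚᵘ (+ 1) n ℚᵘ.* mkℚᵘ (+ suc n) 0        ≈⟨ *≡* cross ⟩
  toℚᵘ 1ℚ                                   ∎)
  where
  open ℚᵘ.≃-Reasoning
  cross : (+ 1 ℤ.* + suc n) ℤ.* + 1 ≡ + 1 ℤ.* + (suc n ℕ.* 1)
  cross = ≡.trans (ℤ.*-identityʳ (+ 1 ℤ.* + suc n))
    (cong (λ m → + 1 ℤ.* + m) (≡.sym (ℕ.*-identityʳ (suc n))))

1/suc>0 : ∀ n → 0ℚ < 1/suc n
1/suc>0 n = ℚ.positive⁻¹ (1/suc n) {{pos}}
  where
  pos : ℚ.Positive (1/suc n)
  pos = ℚ.normalize-pos 1 (suc n)

1≤↑suc : ∀ n → 1ℚ ≤ ↑ (+ suc n)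
1≤↑suc n = ↑-mono-≤ {+ 1} {+ suc n} (ℤ.+≤+ (s≤s z≤n))

1/suc≤1 : ∀ n → 1/suc n ≤ 1ℚ
1/suc≤1 n = +-slack-≤ (*-nonNeg (ℚ.<⇒≤ (1/suc>0 n)) (p≤q⇒0≤q-p (1≤↑suc n)))
  (≡.trans (≡.sym (1/suc-inverse n))
    (solve 2 (λ r m → r :* m := r :+ r :* (m :- con 1ℚ)) ≡.refl (1/suc n) (↑ (+ suc n))))
  where open +-*-Solver

archimedean : ∀ q → ∃[ n ] q ≤ ↑ (+ n)
archimedean q@(ℚ.mkℚ num d _) = ℤ.∣ num ∣ , ℚ.toℚᵘ-cancel-≤ (begin
  toℚᵘ q                  ≤⟨ *≤* cross ⟩
  mkℚᵘ (+ ℤ.∣ num ∣) 0    ≃⟨ toℚᵘ-↑ (+ ℤ.∣ num ∣) ⟨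
  toℚᵘ (↑ (+ ℤ.∣ num ∣))  ∎)
  where
  open ℚᵘ.≤-Reasoning
  i≤∣i∣ : ∀ i → i ℤ.≤ + ℤ.∣ i ∣
  i≤∣i∣ (+ n)        = ℤ.≤-refl
  i≤∣i∣ ℤ.-[1+ n ]   = ℤ.-≤+
  cross : num ℤ.* + 1 ℤ.≤ + ℤ.∣ num ∣ ℤ.* + suc d
  cross = ℤ.≤-trans (ℤ.≤-trans (ℤ.≤-reflexive (ℤ.*-identityʳ num)) (i≤∣i∣ num))
    (ℤ.≤-trans (ℤ.+≤+ (ℕ.m≤m*n ℤ.∣ num ∣ (suc d))) (ℤ.≤-reflexive (ℤ.pos-* ℤ.∣ num ∣ (suc d))))

^-nonNeg : ∀ {x} n → 0ℚ ≤ x → 0ℚ ≤ x ^ n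
^-nonNeg zero    0≤x = ℚ.nonNegative⁻¹ 1ℚ
^-nonNeg (suc n) 0≤x = *-nonNeg 0≤x (^-nonNeg n 0≤x)

*-mono-≤ : ∀ {a b c d} → 0ℚ ≤ a → 0ℚ ≤ c → a ≤ b → c ≤ d → a * c ≤ b * d
*-mono-≤ {a} {b} {c} {d} 0≤a 0≤c a≤b c≤d = ℚ.≤-trans
  (ℚ.*-monoˡ-≤-nonNeg a {{ℚ.nonNegative 0≤a}} c≤d)
  (ℚ.*-monoʳ-≤-nonNeg d {{ℚ.nonNegative (ℚ.≤-trans 0≤c c≤d)}} a≤b)

^-mono-≤ : ∀ {x y} n → 0ℚ ≤ x → x ≤ y → x ^ n ≤ y ^ n
^-mono-≤ zero    0≤x x≤y = ℚ.≤-refl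
^-mono-≤ (suc n) 0≤x x≤y = *-mono-≤ 0≤x (^-nonNeg n 0≤x) x≤y (^-mono-≤ n 0≤x x≤y)

1^n≡1 : ∀ n → 1ℚ ^ n ≡ 1ℚ
1^n≡1 zero    = ≡.refl
1^n≡1 (suc n) = ≡.trans (ℚ.*-identityˡ (1ℚ ^ n)) (1^n≡1 n)

bernoulli : ∀ n {x} → 0ℚ ≤ 1ℚ + x → 1ℚ + ↑ (+ n) * x ≤ (1ℚ + x) ^ n
bernoulli zero    {x} _     = ℚ.≤-reflexive (solve 1 (λ x → con 1ℚ :+ con 0ℚ :* x := con 1ℚ) ≡.refl x)
  where open +-*-Solver
bernoulli (suc n) {x} 0≤1+x = ℚ.≤-trans
  (+-slack-≤ (*-nonNeg (↑-mono-≤ {+ 0} {+ n} (ℤ.+≤+ z≤n)) (0≤x² x))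
    (≡.trans (solve 2 (λ m x → (con 1ℚ :+ x) :* (con 1ℚ :+ m :* x) :=
        (con 1ℚ :+ (con 1ℚ :+ m) :* x) :+ m :* (x :* x)) ≡.refl (↑ (+ n)) x)
      (cong (λ m → (1ℚ + m * x) + ↑ (+ n) * (x * x)) (≡.sym (↑-+ (+ 1) (+ n))))))
  (ℚ.*-monoˡ-≤-nonNeg (1ℚ + x) {{ℚ.nonNegative 0≤1+x}} (bernoulli n 0≤1+x))
  where open +-*-Solver

expApprox : ℕ → ℚ → ℚ
expApprox n y = (1ℚ + y * 1/suc n) ^ suc n

2ℚ : ℚ
2ℚ = ↑ (+ 2)

¼ : ℚ
¼ = + 1 ℚ./ 4

-- A finite form of exp(¼) ≤ 4/3. With z = ¼/m, Bernoulli gives (1 - z)ᵐ ≥ ¾, while (1 + z)ᵐ (1 -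
-- z)ᵐ = (1 - z²)ᵐ ≤ 1.
expApprox-≤¼ : ∀ n {y} → 0ℚ ≤ 1ℚ + y * 1/suc n → y ≤ ¼ → expApprox n y * (1ℚ - ¼) ≤ 1ℚ
expApprox-≤¼ n {y} 0≤ y≤¼ = begin
  expApprox n y * (1ℚ - ¼)
    ≤⟨ *-mono-≤ (^-nonNeg m 0≤) (toWitness {a? = 0ℚ ℚ.≤? 1ℚ - ¼} _)
         (^-mono-≤ m 0≤ (ℚ.+-monoʳ-≤ 1ℚ (ℚ.*-monoʳ-≤-nonNeg r {{r-nonNeg}} y≤¼))) bound ⟩
  (1ℚ + z) ^ m * (1ℚ + ℚ.- z) ^ m
    ≡⟨ ^-distrib-* (1ℚ + z) (1ℚ + ℚ.- z) m ⟨
  ((1ℚ + z) * (1ℚ + ℚ.- z)) ^ m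
    ≤⟨ ^-mono-≤ m (*-nonNeg (ℚ.+-mono-≤ (ℚ.nonNegative⁻¹ 1ℚ) 0≤z) 0≤1-z)
         (+-slack-≤ (0≤x² z) (solve 1 (λ z → con 1ℚ :=
           (con 1ℚ :+ z) :* (con 1ℚ :+ (:- z)) :+ z :* z) ≡.refl z)) ⟩
  1ℚ ^ m
    ≡⟨ 1^n≡1 m ⟩
  1ℚ ∎
  where
  open ℚ.≤-Reasoning
  open +-*-Solver
  m = suc n
  r = 1/suc n
  z = ¼ * r
  0≤r : 0ℚ ≤ r
  0≤r = ℚ.<⇒≤ (1/suc>0 n)
  r-nonNeg : ℚ.NonNegative r
  r-nonNeg = ℚ.nonNegative 0≤r
  0≤z : 0ℚ ≤ z
  0≤z = *-nonNeg (ℚ.nonNegative⁻¹ ¼) 0≤r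
  0≤1-z : 0ℚ ≤ 1ℚ + ℚ.- z
  0≤1-z = p≤q⇒0≤q-p (ℚ.≤-trans (ℚ.*-monoˡ-≤-nonNeg ¼ (1/suc≤1 n)) (toWitness {a? = ¼ * 1ℚ ℚ.≤? 1ℚ} _))
  bound : 1ℚ - ¼ ≤ (1ℚ + ℚ.- z) ^ m
  bound = subst (_≤ (1ℚ + ℚ.- z) ^ m)
    (≡.trans (solve 2 (λ m r → con 1ℚ :+ m :* (:- (con ¼ :* r)) := con 1ℚ :- con ¼ :* (r :* m)) ≡.refl (↑ (+ m)) r)
             (cong (λ u → 1ℚ - ¼ * u) (1/suc-inverse n)))
    (bernoulli m 0≤1-z)

seq-^ : ∀ x n k → seq (x ^ℝ n) k ≡ seq x k ^ n
seq-^ x zero    k = ≡.refl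
seq-^ x (suc n) k = cong (seq x k *_) (seq-^ x n k)

-- The outer index is the stage of the limit, the inner one that of the Cauchy sequences; the inner
-- threshold depends on the stage. The strictness of `_<ℝ_` supplies slacks that are simply dropped.
IsExp⇒expApprox : ∀ {y x} → IsExp y x → ∀ ε → 0ℚ < ε → Eventually λ n → Eventually λ k →
  (seq x k - ε ≤ expApprox n (seq y k)) × (expApprox n (seq y k) ≤ seq x k + ε)
IsExp⇒expApprox {y} {x} exp ε 0<ε = eventually-map close (exp ε 0<ε)
  where
  open +-*-Solver
  close : ∀ n → _ → Eventually λ k →
    (seq x k - ε ≤ expApprox n (seq y k)) × (expApprox n (seq y k) ≤ seq x k + ε)
  close n ((e , 0<e , lower) , (e′ , 0<e′ , upper)) = eventually-map (λ k (lo , hi) →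
    subst (λ a → (seq x k - ε ≤ a) × (a ≤ seq x k + ε)) (seq-^ base (suc n) k)
      ( +-slack-≤ (ℚ.+-mono-≤ (ℚ.<⇒≤ 0<e) (p≤q⇒0≤q-p lo))
          (solve 4 (λ a x ε e → a := (x :- ε) :+ (e :+ ((a :- x) :- ((:- ε) :+ e)))) ≡.refl
            (seq (base ^ℝ suc n) k) (seq x k) ε e)
      , +-slack-≤ (ℚ.+-mono-≤ (ℚ.<⇒≤ 0<e′) (p≤q⇒0≤q-p hi))
          (solve 4 (λ a x ε e → x :+ ε := a :+ (e :+ (ε :- ((a :- x) :+ e)))) ≡.refl
            (seq (base ^ℝ suc n) k) (seq x k) ε e′)))
    (eventually-× lower upper)
    where base = fromℕ 1 +ℝ y *ℝ fromℚ (1/suc n)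

-- For y < ¼ the previous bound would give 3/2 · 3/4 = 9/8 ≤ 1. The bound on -y keeps the base of
-- the power nonnegative.
expApprox-lower⇒≥¼ : ∀ n {y} → ℚ.- y ≤ ↑ (+ suc n) → 2ℚ - ½ ≤ expApprox n y → ¼ ≤ y
expApprox-lower⇒≥¼ n {y} -y≤m lower with ¼ ℚ.≤? y
... | yes ¼≤y = ¼≤y
... | no  ¼≰y = contradiction
  (toWitness {a? = 1ℚ ℚ.<? (2ℚ - ½) * (1ℚ - ¼)} _)
  (≤⇒≯ (ℚ.≤-trans (ℚ.*-monoʳ-≤-nonNeg (1ℚ - ¼) lower) (expApprox-≤¼ n nonNeg (ℚ.<⇒≤ (ℚ.≰⇒> ¼≰y)))))
  where
  open +-*-Solver
  nonNeg : 0ℚ ≤ 1ℚ + y * 1/suc n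
  nonNeg = +-slack-≤ (*-nonNeg (ℚ.<⇒≤ (1/suc>0 n)) (p≤q⇒0≤q-p -y≤m))
    (≡.trans (cong (λ u → u + y * 1/suc n) (≡.sym (1/suc-inverse n)))
      (solve 3 (λ r m l → r :* m :+ l :* r := con 0ℚ :+ r :* (m :- (:- l))) ≡.refl
        (1/suc n) (↑ (+ suc n)) y))

-- One stage suffices, provided that it also exceeds a bound of |l|, so that the base 1 + l/(n + 1)
-- is nonnegative for all late approximants.
log2≥¼ : ∀ {l} → IsExp l (fromℕ 2) → Eventually (λ k → ¼ ≤ seq l k)
log2≥¼ {l} exp =
  let N , close       = IsExp⇒expApprox {l} {fromℕ 2} exp ½ (ℚ.positive⁻¹ ½)
      B , 0<B , ∣l∣≤B = cauchy⇒bounded l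
      K , B≤K         = archimedean B
      n               = N ⊔ K
      B≤suc-n         = ℚ.≤-trans B≤K (↑-mono-≤ {+ K} {+ suc n} (ℤ.+≤+ (ℕ.m≤n⇒m≤1+n (ℕ.m≤n⊔m N K))))
  in eventually-map (λ k ((lower , _) , ∣lk∣≤B) →
       expApprox-lower⇒≥¼ n (ℚ.≤-trans (-p≤∣p∣ (seq l k)) (ℚ.≤-trans ∣lk∣≤B B≤suc-n)) lower)
     (eventually-× (close n (ℕ.m≤m⊔n N K)) ∣l∣≤B)

2^n*½^n≡1 : ∀ n → 2ℚ ^ n * ½ ^ n ≡ 1ℚ
2^n*½^n≡1 n = ≡.trans (≡.sym (^-distrib-* 2ℚ ½ n)) (1^n≡1 n)

½^n>0 : ∀ n → 0ℚ < ½ ^ n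
½^n>0 zero    = ℚ.positive⁻¹ 1ℚ
½^n>0 (suc n) = *-pos (ℚ.positive⁻¹ ½) (½^n>0 n)

½^n≤1 : ∀ n → ½ ^ n ≤ 1ℚ
½^n≤1 n = subst (½ ^ n ≤_) (1^n≡1 n) (^-mono-≤ n (ℚ.nonNegative⁻¹ ½) (toWitness {a? = ½ ℚ.≤? 1ℚ} _))

1≤2^n : ∀ n → 1ℚ ≤ 2ℚ ^ n
1≤2^n n = subst (_≤ 2ℚ ^ n) (1^n≡1 n) (^-mono-≤ n (ℚ.nonNegative⁻¹ 1ℚ) (toWitness {a? = 1ℚ ℚ.≤? 2ℚ} _))

½^n/n≤1 : ∀ t → ½ ^ suc t * 1/suc t ≤ 1ℚ
½^n/n≤1 t = *-mono-≤ (ℚ.<⇒≤ (½^n>0 (suc t))) (ℚ.<⇒≤ (1/suc>0 t)) (½^n≤1 (suc t)) (1/suc≤1 t)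

module _ (t : ℕ) where
  private
    s = suc t
    τ : ℚ
    τ = ½ ^ s * 1/suc t

  -- Bernoulli applied to 1 - τ/2 loses 2ˢ · sτ/2, and `τ` is chosen to make this exactly ½.
  [2-τ]^s≥2^s-½ : 2ℚ ^ s - ½ ≤ (2ℚ - τ) ^ s
  [2-τ]^s≥2^s-½ = begin
    2ℚ ^ s - ½
      ≡⟨ cong₂ (λ u v → 2ℚ ^ s - ½ * (u * v)) (2^n*½^n≡1 s) (1/suc-inverse t) ⟨
    2ℚ ^ s - ½ * ((2ℚ ^ s * ½ ^ s) * (1/suc t * ↑ (+ s)))
      ≡⟨ solve 4 (λ A H r m → A :- con ½ :* ((A :* H) :* (r :* m)) :=
           A :* (con 1ℚ :+ m :* (:- (con ½ :* (H :* r))))) ≡.refl (2ℚ ^ s) (½ ^ s) (1/suc t) (↑ (+ s)) ⟩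
    2ℚ ^ s * (1ℚ + ↑ (+ s) * x)
      ≤⟨ ℚ.*-monoˡ-≤-nonNeg (2ℚ ^ s) {{ℚ.nonNegative (^-nonNeg s (ℚ.nonNegative⁻¹ 2ℚ))}} (bernoulli s 0≤1+x) ⟩
    2ℚ ^ s * (1ℚ + x) ^ s
      ≡⟨ ^-distrib-* 2ℚ (1ℚ + x) s ⟨
    (2ℚ * (1ℚ + x)) ^ s
      ≡⟨ cong (_^ s) (solve 1 (λ t → con 2ℚ :* (con 1ℚ :+ (:- (con ½ :* t))) := con 2ℚ :- t) ≡.refl τ) ⟩
    (2ℚ - τ) ^ s ∎
    where
    open ℚ.≤-Reasoning
    open +-*-Solver
    x = ℚ.- (½ * τ)
    0≤1+x : 0ℚ ≤ 1ℚ + x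
    0≤1+x = p≤q⇒0≤q-p (ℚ.≤-trans (ℚ.*-monoˡ-≤-nonNeg ½ (½^n/n≤1 t)) (toWitness {a? = ½ * 1ℚ ℚ.≤? 1ℚ} _))

-- (1 + b/(sj))^(2sj) ≥ (1 + l/(2j))^(2js) when b ≥ sl/2, where j = J + 1 and s = t + 1.
module _ (t J : ℕ) where
  private
    s = suc t
    n₁ n₂ : ℕ
    -- Spelled so that `suc n₁` and `suc n₂` are definitionally 2j and sj.
    n₁ = J ℕ.+ (suc J ℕ.+ 0)
    n₂ = J ℕ.+ t ℕ.* suc J

  1/suc-ratio : 1/suc n₁ ≡ ½ * ↑ (+ s) * 1/suc n₂
  1/suc-ratio = begin
    1/suc n₁
      ≡⟨ ℚ.*-identityʳ (1/suc n₁) ⟨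
    1/suc n₁ * 1ℚ
      ≡⟨ cong (1/suc n₁ *_) (≡.trans (≡.sym (1/suc-inverse n₂)) (cong (1/suc n₂ *_) (split s (suc J)))) ⟩
    1/suc n₁ * (1/suc n₂ * (↑ (+ s) * ↑ (+ suc J)))
      ≡⟨ solve 4 (λ r₁ r₂ s j → r₁ :* (r₂ :* (s :* j)) := con ½ :* s :* r₂ :* (r₁ :* (con 2ℚ :* j))) ≡.refl
           (1/suc n₁) (1/suc n₂) (↑ (+ s)) (↑ (+ suc J)) ⟩
    ½ * ↑ (+ s) * 1/suc n₂ * (1/suc n₁ * (2ℚ * ↑ (+ suc J)))
      ≡⟨ cong (½ * ↑ (+ s) * 1/suc n₂ *_)
           (≡.trans (cong (1/suc n₁ *_) (≡.sym (split 2 (suc J)))) (1/suc-inverse n₁)) ⟩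
    ½ * ↑ (+ s) * 1/suc n₂ * 1ℚ
      ≡⟨ ℚ.*-identityʳ _ ⟩
    ½ * ↑ (+ s) * 1/suc n₂ ∎
    where
    open ≡-Reasoning
    open +-*-Solver
    split : ∀ a b → ↑ (+ (a ℕ.* b)) ≡ ↑ (+ a) * ↑ (+ b)
    split a b = ≡.trans (cong ↑_ (ℤ.pos-* a b)) (↑-* (+ a) (+ b))

  expApprox-half-power : ∀ {l b} → 0ℚ ≤ l → ½ * (↑ (+ s) * l) ≤ b →
    expApprox n₁ l ^ s ≤ expApprox n₂ b * expApprox n₂ b
  expApprox-half-power {l} {b} 0≤l ½sl≤b = begin
    ((1ℚ + l * 1/suc n₁) ^ suc n₁) ^ s
      ≡⟨ ^-assocʳ (1ℚ + l * 1/suc n₁) (suc n₁) s ⟩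
    (1ℚ + l * 1/suc n₁) ^ (suc n₁ ℕ.* s)
      ≡⟨ cong ((1ℚ + l * 1/suc n₁) ^_) (exponents s (suc J)) ⟩
    (1ℚ + l * 1/suc n₁) ^ (suc n₂ ℕ.+ suc n₂)
      ≤⟨ ^-mono-≤ (suc n₂ ℕ.+ suc n₂)
           (ℚ.+-mono-≤ (ℚ.nonNegative⁻¹ 1ℚ) (*-nonNeg 0≤l (ℚ.<⇒≤ (1/suc>0 n₁))))
           (ℚ.+-monoʳ-≤ 1ℚ l/2j≤b/sj) ⟩
    (1ℚ + b * 1/suc n₂) ^ (suc n₂ ℕ.+ suc n₂)
      ≡⟨ ^-homo-* (1ℚ + b * 1/suc n₂) (suc n₂) (suc n₂) ⟩
    expApprox n₂ b * expApprox n₂ b ∎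
    where
    open ℚ.≤-Reasoning
    open +-*-Solver
    exponents : ∀ s j → 2 ℕ.* j ℕ.* s ≡ s ℕ.* j ℕ.+ s ℕ.* j
    exponents = ℕSolver.solve-∀
    l/2j≤b/sj : l * 1/suc n₁ ≤ b * 1/suc n₂
    l/2j≤b/sj = begin
      l * 1/suc n₁                        ≡⟨ cong (l *_) 1/suc-ratio ⟩
      l * (½ * ↑ (+ s) * 1/suc n₂)        ≡⟨ solve 3 (λ l s r → l :* (con ½ :* s :* r) := con ½ :* (s :* l) :* r) ≡.refl l (↑ (+ s)) (1/suc n₂) ⟩
      ½ * (↑ (+ s) * l) * 1/suc n₂        ≤⟨ ℚ.*-monoʳ-≤-nonNeg (1/suc n₂) {{ℚ.nonNegative (ℚ.<⇒≤ (1/suc>0 n₂))}} ½sl≤b ⟩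
      b * 1/suc n₂                        ∎

-- The error budget: the lower side loses ½ from 2ˢ. The upper side is x² + 2xσ + σ² with σ = ½ˢ/16;
-- as x ≤ 2ˢ, it is at most 2ˢ - ¾ + 1/8 + 1/16, which is below 2ˢ - ½ by 1/16.
expApprox-contradiction : ∀ t J {l b x} → let s = suc t; n₁ = J ℕ.+ (suc J ℕ.+ 0); n₂ = J ℕ.+ t ℕ.* suc J in
  ¼ ≤ l → ½ * (↑ (+ s) * l) ≤ b → x * x + (1ℚ - ¼) ≤ 2ℚ ^ s →
  2ℚ - ½ ^ s * 1/suc t ≤ expApprox n₁ l → expApprox n₂ b ≤ x + ¼ * ¼ * ½ ^ s → ⊥
expApprox-contradiction t J {l} {b} {x} ¼≤l ½sl≤b x²+¾≤2^s F≥ G≤ = ≤⇒≯ (begin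
  2ℚ ^ s - ½              ≤⟨ [2-τ]^s≥2^s-½ t ⟩
  (2ℚ - τ) ^ s            ≤⟨ ^-mono-≤ s 0≤2-τ F≥ ⟩
  expApprox n₁ l ^ s      ≤⟨ expApprox-half-power t J 0≤l ½sl≤b ⟩
  G * G                   ≤⟨ *-mono-≤ 0≤G 0≤G G≤ G≤ ⟩
  (x + σ) * (x + σ)       ∎)
  (+-slack-< (ℚ.+-mono-≤-< (ℚ.+-mono-≤ (ℚ.+-mono-≤ (p≤q⇒0≤q-p x²+¾≤2^s)
      (*-nonNeg (*-nonNeg (ℚ.nonNegative⁻¹ 2ℚ) 0≤σ) (p≤q⇒0≤q-p x≤Q)))
      (p≤q⇒0≤q-p σ²≤κ)) 0<rest)
    (solve 3 (λ x σ Q → Q :- con ½ := (x :+ σ) :* (x :+ σ) :+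
      ((((Q :- (x :* x :+ con (1ℚ - ¼))) :+ con 2ℚ :* σ :* (Q :- x)) :+ (con κ :- σ :* σ)) :+
       (con (1ℚ - ¼) :- con ½ :- con κ :- con 2ℚ :* (σ :* Q)))) ≡.refl x σ Q))
  where
  open ℚ.≤-Reasoning
  open +-*-Solver
  s = suc t
  n₁ = J ℕ.+ (suc J ℕ.+ 0)
  n₂ = J ℕ.+ t ℕ.* suc J
  τ = ½ ^ s * 1/suc t
  G = expApprox n₂ b
  κ = ¼ * ¼
  σ = κ * ½ ^ s
  Q = 2ℚ ^ s
  0≤l : 0ℚ ≤ l
  0≤l = ℚ.≤-trans (ℚ.nonNegative⁻¹ ¼) ¼≤l
  0≤σ : 0ℚ ≤ σ
  0≤σ = *-nonNeg (ℚ.nonNegative⁻¹ κ) (ℚ.<⇒≤ (½^n>0 s))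
  σ≤κ : σ ≤ κ
  σ≤κ = ℚ.*-monoˡ-≤-nonNeg κ (½^n≤1 s)
  σ²≤κ : σ * σ ≤ κ
  σ²≤κ = ℚ.≤-trans (*-mono-≤ 0≤σ 0≤σ σ≤κ σ≤κ) (toWitness {a? = κ * κ ℚ.≤? κ} _)
  σQ≡κ : σ * Q ≡ κ
  σQ≡κ = ≡.trans (solve 3 (λ k H Q → k :* H :* Q := k :* (Q :* H)) ≡.refl κ (½ ^ s) Q)
    (≡.trans (cong (κ *_) (2^n*½^n≡1 s)) (ℚ.*-identityʳ κ))
  0<rest : 0ℚ < 1ℚ - ¼ - ½ - κ - 2ℚ * (σ * Q)
  0<rest = subst (λ u → 0ℚ < 1ℚ - ¼ - ½ - κ - 2ℚ * u) (≡.sym σQ≡κ)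
    (toWitness {a? = 0ℚ ℚ.<? 1ℚ - ¼ - ½ - κ - 2ℚ * κ} _)
  Q≤Q² : Q ≤ Q * Q
  Q≤Q² = +-slack-≤ (*-nonNeg (ℚ.≤-trans (ℚ.nonNegative⁻¹ 1ℚ) (1≤2^n s)) (p≤q⇒0≤q-p (1≤2^n s)))
    (solve 1 (λ Q → Q :* Q := Q :+ Q :* (Q :- con 1ℚ)) ≡.refl Q)
  x≤Q : x ≤ Q
  x≤Q = ℚ.≤-trans (p≤∣p∣ x) (ℚ.<⇒≤ (p²<q²⇒∣p∣<q
    (ℚ.<-≤-trans (ℚ.positive⁻¹ 1ℚ) (1≤2^n s))
    (ℚ.<-≤-trans (+-slack-< (ℚ.positive⁻¹ (1ℚ - ¼)) ≡.refl) (ℚ.≤-trans x²+¾≤2^s Q≤Q²))))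
  0≤2-τ : 0ℚ ≤ 2ℚ - τ
  0≤2-τ = p≤q⇒0≤q-p (ℚ.≤-trans (½^n/n≤1 t) (toWitness {a? = 1ℚ ℚ.≤? 2ℚ} _))
  0≤b : 0ℚ ≤ b
  0≤b = ℚ.≤-trans (*-nonNeg (ℚ.nonNegative⁻¹ ½) (*-nonNeg (↑-mono-≤ {+ 0} {+ s} (ℤ.+≤+ z≤n)) 0≤l)) ½sl≤b
  0≤G : 0ℚ ≤ G
  0≤G = ^-nonNeg (suc n₂) (ℚ.+-mono-≤ (ℚ.nonNegative⁻¹ 1ℚ) (*-nonNeg 0≤b (ℚ.<⇒≤ (1/suc>0 n₂))))

-- The excess ε of β over ½ is worth at least ε/4 after multiplication by ml ≥ ¼, and this pays for
-- the error allowed in β · ml ≈ b. Here the positive lower bound on log 2 is essential.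
β-lower : ∀ t {β l b ε} → let m = ↑ (+ suc t) in 0ℚ < ε → ¼ ≤ l → ½ + ε ≤ β →
          ∣ β * (m * l) - b ∣ ≤ ε * ¼ → ½ * (m * l) ≤ b
β-lower t {β} {l} {b} {ε} 0<ε ¼≤l ½+ε≤β close = +-slack-≤
  (ℚ.+-mono-≤ (ℚ.+-mono-≤
    (*-nonNeg (p≤q⇒0≤q-p ½+ε≤β) (ℚ.≤-trans (ℚ.nonNegative⁻¹ ¼) ¼≤ml))
    (p≤q⇒0≤q-p (ℚ.≤-trans (p≤∣p∣ (β * (m * l) - b)) close)))
    (*-nonNeg (ℚ.<⇒≤ 0<ε) (p≤q⇒0≤q-p ¼≤ml)))
  (solve 4 (λ β ml b ε → b := con ½ :* ml :+
    (((β :- (con ½ :+ ε)) :* ml :+ (ε :* con ¼ :- (β :* ml :- b))) :+ ε :* (ml :- con ¼))) ≡.refl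
    β (m * l) b ε)
  where
  open +-*-Solver
  m = ↑ (+ suc t)
  ¼≤ml : ¼ ≤ m * l
  ¼≤ml = ℚ.≤-trans ¼≤l (+-slack-≤
    (*-nonNeg (p≤q⇒0≤q-p (1≤↑suc t)) (ℚ.≤-trans (ℚ.nonNegative⁻¹ ¼) ¼≤l))
    (solve 2 (λ m l → m :* l := l :+ (m :- con 1ℚ) :* l) ≡.refl m l))

½<β⇒2^s≮λ² : ∀ t {l b β x} → let s = suc t in
  IsExp l (fromℕ 2) → IsExp b x → β *ℝ (fromℕ s *ℝ l) ≃ b → fromℚ ½ <ℝ β →
  ¬ Eventually (λ k → seq x k * seq x k + (1ℚ - ¼) ≤ 2ℚ ^ s)
½<β⇒2^s≮λ² t {l} {b} {β} {x} exp-l exp-b βsl≃b (ε , 0<ε , ½+ε≤β) x²+¾≤2^s =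
  let N₁ , close-l = IsExp⇒expApprox {l} {fromℕ 2} exp-l (½ ^ suc t * 1/suc t) (*-pos (½^n>0 (suc t)) (1/suc>0 t))
      N₂ , close-b = IsExp⇒expApprox {b} {x} exp-b (¼ * ¼ * ½ ^ suc t) (*-pos (ℚ.positive⁻¹ (¼ * ¼)) (½^n>0 (suc t)))
      J            = N₁ ℕ.+ N₂
      -- The stages must be fixed before `k`, since the thresholds for `k` depend on them; both
      -- stages are at least J = N₁ + N₂.
      k , (F≥ , _) , (_ , G≤) , ¼≤l , x² , ½+ε≤βk , close = eventually-witness
        (eventually-× (close-l (J ℕ.+ (suc J ℕ.+ 0)) (ℕ.≤-trans (ℕ.m≤m+n N₁ N₂) (ℕ.m≤m+n J _)))
        (eventually-× (close-b (J ℕ.+ t ℕ.* suc J) (ℕ.≤-trans (ℕ.m≤n+m N₂ N₁) (ℕ.m≤m+n J _)))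
        (eventually-× (log2≥¼ {l} exp-l)
        (eventually-× x²+¾≤2^s
        (eventually-× ½+ε≤β (βsl≃b (ε * ¼) (*-pos 0<ε (ℚ.positive⁻¹ ¼))))))))
  in expApprox-contradiction t J {seq l k} {seq b k} {seq x k} ¼≤l
       (β-lower t {seq β k} 0<ε ¼≤l ½+ε≤βk (ℚ.<⇒≤ close)) x² F≥ G≤

-- The order of 2 and the conclusion

order-unique : ∀ {p s s′} → IsOrderOf2 p s → IsOrderOf2 p s′ → s ≡ s′
order-unique {s = s} {s′} (0<s , 2^s≡1 , least) (0<s′ , 2^s′≡1 , least′) =
  ℕ.≤-antisym (least s′ 0<s′ 2^s′≡1) (least′ s 0<s 2^s≡1)

order⇒<2^ : ∀ {p s} → IsOrderOf2 p s → p ℕ.< 2 ℕ.^ s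
order⇒<2^ {p} {s} (0<s , 2^s≡1 , _) = ℕ.≤-trans
  (s≤s (ℕ.∣⇒≤ {{ℕ.>-nonZero (ℕ.m<n⇒0<n∸m 1<2^s)}} p∣2^s∸1))
  (ℕ.≤-reflexive (ℕ.m+[n∸m]≡n (ℕ.<⇒≤ 1<2^s)))
  where
  1<2^s : 1 ℕ.< 2 ℕ.^ s
  1<2^s = ℕ.^-monoʳ-< 2 (s≤s (s≤s z≤n)) 0<s
  p∣2^s∸1 : p ℕ.∣ 2 ℕ.^ s ℕ.∸ 1
  p∣2^s∸1 = ∣⇒∣ᵤ (subst (+ p ∣_) (≡.sym (pos-∸ (ℕ.<⇒≤ 1<2^s))) 2^s≡1)

≡3mod4⇒half-odd : ∀ {p} → p % 4 ≡ 3 →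
  ∃[ t ] p ≡ suc (suc (2 ℕ.* t) ℕ.+ suc (2 ℕ.* t)) × (p ℕ.∸ 1) / 2 ≡ suc (2 ℕ.* t)
≡3mod4⇒half-odd {p} p%4≡3 = t , p≡ , (begin
  (p ℕ.∸ 1) / 2                          ≡⟨ cong (λ m → (m ℕ.∸ 1) / 2) p≡ ⟩
  (suc (2 ℕ.* t) ℕ.+ suc (2 ℕ.* t)) / 2  ≡⟨ cong (_/ 2) (twice (suc (2 ℕ.* t))) ⟩
  suc (2 ℕ.* t) ℕ.* 2 / 2                ≡⟨ m*n/n≡m (suc (2 ℕ.* t)) 2 ⟩
  suc (2 ℕ.* t)                          ∎)
  where
  open ≡-Reasoning
  t = p / 4
  twice : ∀ m → m ℕ.+ m ≡ m ℕ.* 2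
  twice = ℕSolver.solve-∀
  regroup : ∀ t → 3 ℕ.+ t ℕ.* 4 ≡ suc (suc (2 ℕ.* t) ℕ.+ suc (2 ℕ.* t))
  regroup = ℕSolver.solve-∀
  p≡ : p ≡ suc (suc (2 ℕ.* t) ℕ.+ suc (2 ℕ.* t))
  p≡ = ≡.trans (m≡m%n+[m/n]*n p 4) (≡.trans (cong (ℕ._+ t ℕ.* 4) p%4≡3) (regroup t))

↑-2^ : ∀ n → ↑ (+ (2 ℕ.^ n)) ≡ 2ℚ ^ n
↑-2^ zero    = ≡.refl
↑-2^ (suc n) = ≡.trans (cong ↑_ (ℤ.pos-* 2 (2 ℕ.^ n)))
  (≡.trans (↑-* (+ 2) (+ (2 ℕ.^ n))) (cong (2ℚ *_) (↑-2^ n)))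

proposition5p7 : ¬ (∃[ p ] P₂₃ p × ∃[ β ] IsBeta p β × fromℚ ½ <ℝ β)
proposition5p7 (p , (pr , p≢2 , p%4≡3 , ord) , β , isBeta , ½<β)
  with t , p≡ , half ← ≡3mod4⇒half-odd {p} p%4≡3
  with record { s = s ; λ₁ = λ₁ ; log-λ₁ = b ; log-2 = l ; s-order = s-order
              ; λ₁-largest = (μ , (v , v≢0 , Mv≃μv) , _ , λ₁²≃∣μ∣²) , _
              ; log-λ₁-log = exp-b ; log-2-log = exp-l ; b-quotient = quot } ← isBeta
  -- The order stored in `isBeta` is identified with (p - 1) / 2 = 2t + 1, the odd number that the
  -- norm bound asks for.
  with ≡.refl ← ≡.trans (order-unique {p} s-order ord) half
  = ½<β⇒2^s≮λ² (2 ℕ.* t) {l} {b} {β} {λ₁} exp-l exp-b quot ½<β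
      (eventually-map (λ k → widen (seq λ₁ k * seq λ₁ k))
        (modulus²≤ {p} {suc (2 ℕ.* t)} (↑ (+ p)) (rowSum-bound {p} {t} pr p≢2 p≡ s-order)
          μ λ₁ v v≢0 Mv≃μv λ₁²≃∣μ∣² ¼ (ℚ.positive⁻¹ ¼)))
  where
  open +-*-Solver
  -- Of the unit gap in p + 1 ≤ 2ˢ, a quarter is spent on the tolerance in λ₁² ≤ p + ¼; the other
  -- three quarters remain for the comparison of powers.
  widen : ∀ x² → x² ≤ ↑ (+ p) + ¼ → x² + (1ℚ - ¼) ≤ 2ℚ ^ s
  widen x² x²≤ = begin
    x² + (1ℚ - ¼)              ≤⟨ ℚ.+-monoˡ-≤ (1ℚ - ¼) x²≤ ⟩
    ↑ (+ p) + ¼ + (1ℚ - ¼)     ≡⟨ solve 1 (λ q → q :+ con ¼ :+ con (1ℚ - ¼) := con 1ℚ :+ q) ≡.refl (↑ (+ p)) ⟩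
    1ℚ + ↑ (+ p)               ≡⟨ ↑-+ (+ 1) (+ p) ⟨
    ↑ (+ suc p)                ≤⟨ ↑-mono-≤ (ℤ.+≤+ (order⇒<2^ {p} s-order)) ⟩
    ↑ (+ (2 ℕ.^ s))            ≡⟨ ↑-2^ s ⟩
    2ℚ ^ s                     ∎
    where open ℚ.≤-Reasoning
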